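{- Let $\Phi$ be any root system with weight lattice $P$ and Weyl group $W$, and let $v \in P$. Then unlabeled central-firing for $\Phi$ is confluent from $v$; that is, there exists $v' \in V$ such that any sequence of unlabeled central-firing moves starting at the orbit $W.v$ terminates at $W.v'$ (there is no infinite sequence of moves starting at $W.v$, and every sequence of moves starting at $W.v$ that cannot be continued ends at $W.v'$).
   Context: Here $\Phi$ is a (reduced, crystallographic) root system in a finite-dimensional real inner product space $(V,\langle\cdot,\cdot\rangle)$, spanning $V$. For $\alpha \in \Phi$ put $\alpha^\vee := 2\alpha/\langle\alpha,\alpha\rangle$. $W$ is the Weyl group, generated by the reflections $s_\alpha(u) = u - \langle u,\alpha^\vee\rangle\alpha$, $\alpha\in\Phi$. A set of simple roots is fixed and $\Phi^+$ denotes the corresponding set of positive roots. The weight lattice is $P := \{u\in V : \langle u,\alpha^\vee\rangle\in\mathbb{Z} \text{ for all } \alpha\in\Phi\}$. For $u \in V$, $W.u$ denotes its $W$-orbit. An unlabeled central-firing move consists of replacing an orbit by $W.(u+\alpha)$, where $u$ is some element of that orbit and $\alpha\in\Phi^+$ is a positive root orthogonal to $u$. -}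

module Defs where

open import Level using (Level; _⊔_) renaming (suc to lsuc)
open import Algebra.Bundles using (CommutativeRing)
open import Algebra.Module.Bundles using (Module)
import Algebra.Definitions.RawMonoid as RawMonoidDefs
open import Data.Fin.Base using (Fin)
open import Data.Integer.Base using (ℤ; +_; -[1+_])
open import Data.List.Base using (List; foldr)
open import Data.Nat.Base using (ℕ; suc)
open import Data.Product.Base using (∃; ∃-syntax; _×_)
open import Data.Sum.Base using (_⊎_)
open import Data.Vec.Functional using (Vector)
open import Relation.Binary.Core using (Rel)
open import Relation.Binary.Structures using (IsDecTotalOrder)
open import Relation.Nullary.Negation.Core using (¬_)
open import Relation.Unary using (Pred; _∈_; _≐_)

-- The standard library has no real numbers, so they enter through their
-- classical characterisation: ℝ is the Dedekind-complete totally ordered field.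
-- As usual for the classical reals, the order and equality are decidable.
record RealNumbers (c ℓ₁ ℓ₂ : Level) : Set (lsuc (c ⊔ ℓ₁ ⊔ ℓ₂)) where
  infix  4 _≤_
  infix  8 _⁻¹
  field
    commutativeRing : CommutativeRing c ℓ₁

  open CommutativeRing commutativeRing public

  field
    -- Total function; no law fixes the value of 0# ⁻¹.
    _⁻¹             : Carrier → Carrier
    ⁻¹-cong         : ∀ {x y} → x ≈ y → x ⁻¹ ≈ y ⁻¹
    ⁻¹-inverse      : ∀ {x} → ¬ (x ≈ 0#) → x * x ⁻¹ ≈ 1#
    0≉1             : ¬ (0# ≈ 1#)

    _≤_             : Rel Carrier ℓ₂
    isDecTotalOrder : IsDecTotalOrder _≈_ _≤_
    +-monoˡ-≤       : ∀ z {x y} → x ≤ y → x + z ≤ y + z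
    *-nonNegative   : ∀ {x y} → 0# ≤ x → 0# ≤ y → 0# ≤ x * y

  UpperBound : Pred Carrier (c ⊔ ℓ₁ ⊔ ℓ₂) → Carrier → Set (c ⊔ ℓ₁ ⊔ ℓ₂)
  UpperBound S b = ∀ {x} → x ∈ S → x ≤ b

  field
    complete : (S : Pred Carrier (c ⊔ ℓ₁ ⊔ ℓ₂)) → ∃[ x ] x ∈ S → ∃[ b ] UpperBound S b →
               ∃[ s ] (UpperBound S s × (∀ {b} → UpperBound S b → s ≤ b))

  open RawMonoidDefs +-rawMonoid public using () renaming (_×_ to _×ᴿ_)

  fromℤ : ℤ → Carrier
  fromℤ (+ n)    = n ×ᴿ 1#
  fromℤ -[1+ n ] = - (suc n ×ᴿ 1#)

  IsInteger : Carrier → Set ℓ₁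
  IsInteger x = ∃[ k ] x ≈ fromℤ k

module LinearAlgebra {c ℓ₁ ℓ₂ m ℓm : Level} (ℝ : RealNumbers c ℓ₁ ℓ₂)
                     (V : Module (RealNumbers.commutativeRing ℝ) m ℓm) where
  open RealNumbers ℝ
  open Module V
  open RawMonoidDefs +ᴹ-rawMonoid public using () renaming (_×_ to _×ᴹ_; sum to sumᴹ)

  linComb : {n : ℕ} → Vector Carrier n → Vector Carrierᴹ n → Carrierᴹ
  linComb a b = sumᴹ (λ i → a i *ₗ b i)

  Spanning : {n : ℕ} → Vector Carrierᴹ n → Set (c ⊔ m ⊔ ℓm)
  Spanning b = ∀ u → ∃[ a ] u ≈ᴹ linComb a b

  LinearlyIndependent : {n : ℕ} → Vector Carrierᴹ n → Set (c ⊔ ℓ₁ ⊔ ℓm)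
  LinearlyIndependent b = ∀ a → linComb a b ≈ᴹ 0ᴹ → ∀ i → a i ≈ 0#

  IsBasis : {n : ℕ} → Vector Carrierᴹ n → Set (c ⊔ ℓ₁ ⊔ m ⊔ ℓm)
  IsBasis b = Spanning b × LinearlyIndependent b

record InnerProductSpace {c ℓ₁ ℓ₂ : Level} (ℝ : RealNumbers c ℓ₁ ℓ₂) (m ℓm : Level) :
       Set (c ⊔ ℓ₁ ⊔ ℓ₂ ⊔ lsuc (m ⊔ ℓm)) where
  open RealNumbers ℝ
  field
    vectorSpace : Module commutativeRing m ℓm

  open Module vectorSpace public
    using ( Carrierᴹ; _≈ᴹ_; _+ᴹ_; -ᴹ_; 0ᴹ; _*ₗ_ )
  open LinearAlgebra ℝ vectorSpace public

  field
    finiteDimensional : ∃[ n ] ∃ λ (b : Vector Carrierᴹ n) → IsBasis b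

    ⟨_,_⟩        : Carrierᴹ → Carrierᴹ → Carrier
    ⟨⟩-cong      : ∀ {u u′ v v′} → u ≈ᴹ u′ → v ≈ᴹ v′ → ⟨ u , v ⟩ ≈ ⟨ u′ , v′ ⟩
    ⟨⟩-sym       : ∀ u v → ⟨ u , v ⟩ ≈ ⟨ v , u ⟩
    ⟨⟩-additive  : ∀ u v w → ⟨ u +ᴹ v , w ⟩ ≈ ⟨ u , w ⟩ + ⟨ v , w ⟩
    ⟨⟩-scalar    : ∀ a u v → ⟨ a *ₗ u , v ⟩ ≈ a * ⟨ u , v ⟩
    ⟨⟩-nonNeg    : ∀ u → 0# ≤ ⟨ u , u ⟩
    ⟨⟩-definite  : ∀ u → ⟨ u , u ⟩ ≈ 0# → u ≈ᴹ 0ᴹ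

  _⊥_ : Rel Carrierᴹ ℓ₁
  u ⊥ v = ⟨ u , v ⟩ ≈ 0#

  -- Meaningful for α ≉ 0 only.
  coroot : Carrierᴹ → Carrierᴹ
  coroot α = ((1# + 1#) * ⟨ α , α ⟩ ⁻¹) *ₗ α

  reflect : Carrierᴹ → Carrierᴹ → Carrierᴹ
  reflect α u = u +ᴹ -ᴹ (⟨ u , coroot α ⟩ *ₗ α)

-- The finite set Φ is given by an enumeration, possibly with repetitions.
record RootSystem {c ℓ₁ ℓ₂ m ℓm : Level} {ℝ : RealNumbers c ℓ₁ ℓ₂}
                  (V : InnerProductSpace ℝ m ℓm) : Set (c ⊔ ℓ₁ ⊔ m ⊔ ℓm) where
  open RealNumbers ℝ
  open InnerProductSpace V
  field
    size : ℕ
    root : Vector Carrierᴹ size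

  Φ : Pred Carrierᴹ ℓm
  Φ α = ∃[ i ] α ≈ᴹ root i

  field
    nonZero          : ∀ {α} → α ∈ Φ → ¬ (α ≈ᴹ 0ᴹ)
    spanning         : Spanning root
    reflectionClosed : ∀ {α β} → α ∈ Φ → β ∈ Φ → reflect α β ∈ Φ
    crystallographic : ∀ {α β} → α ∈ Φ → β ∈ Φ → IsInteger ⟨ β , coroot α ⟩
    reduced          : ∀ {α} a → α ∈ Φ → a *ₗ α ∈ Φ → a ≈ 1# ⊎ a ≈ - 1#

  WeightLattice : Pred Carrierᴹ (ℓ₁ ⊔ m ⊔ ℓm)
  WeightLattice u = ∀ {α} → α ∈ Φ → IsInteger ⟨ u , coroot α ⟩

  -- Reflections are involutions, so the elements of the Weyl group are exactly
  -- the finite products of reflections; a list of indices of roots denotes the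
  -- product of the corresponding reflections.
  act : List (Fin size) → Carrierᴹ → Carrierᴹ
  act w u = foldr (λ i → reflect (root i)) u w

  orbit : Carrierᴹ → Pred Carrierᴹ ℓm
  orbit u u′ = ∃[ w ] u′ ≈ᴹ act w u

record SimpleRoots {c ℓ₁ ℓ₂ m ℓm : Level} {ℝ : RealNumbers c ℓ₁ ℓ₂}
                   {V : InnerProductSpace ℝ m ℓm} (R : RootSystem V) :
       Set (c ⊔ ℓ₁ ⊔ m ⊔ ℓm) where
  open InnerProductSpace V
  open RootSystem R
  field
    rank       : ℕ
    simple     : Vector Carrierᴹ rank
    simple∈Φ   : ∀ i → simple i ∈ Φ
    isBasis    : IsBasis simple

  NonNegComb : Pred Carrierᴹ ℓm
  NonNegComb u = ∃ λ (k : Vector ℕ rank) → u ≈ᴹ sumᴹ (λ i → k i ×ᴹ simple i)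

  field
    signed     : ∀ {α} → α ∈ Φ → NonNegComb α ⊎ NonNegComb (-ᴹ α)

  Φ⁺ : Pred Carrierᴹ ℓm
  Φ⁺ α = α ∈ Φ × NonNegComb α

  -- Moves are between W-orbits, represented as subsets of V.
  infix 4 _⟶_
  _⟶_ : Rel (Pred Carrierᴹ ℓm) (ℓ₁ ⊔ m ⊔ ℓm)
  O ⟶ O′ = ∃[ u ] ∃[ α ] (O ≐ orbit u × α ∈ Φ⁺ × u ⊥ α × O′ ≐ orbit (u +ᴹ α))

{-# OPTIONS --safe #-}

-- For a root α orthogonal to u, the reflection in α maps u + α to u − α, so a
-- move may use α or −α at will.  Let α and β be roots orthogonal to u.  The
-- orbits of u + α and u + β are joined by at most one move each: this only
-- involves the rank 2 subsystem spanned by α and β, where the Cartan integers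
-- ⟨α, β^∨⟩, ⟨β, α^∨⟩ have product at most 4.  For termination, describe u by
-- its integral coordinates ⟨u, β^∨⟩, β ∈ Φ.  The coordinate vectors of u and of
-- α ⊥ u are orthogonal, because the reflection in α permutes Φ; hence the
-- squared distance to a fixed integral vector d changes by |α|² − 2 (d · α).
-- If 2 |d · α| > |α|² for all roots, one of u + α and u − α is closer to d.
-- Newman's lemma concludes.

module Submission where

open import Defs
open import Level using (Level; _⊔_) renaming (suc to lsuc)
open import Algebra.Module.Bundles using (Module)
import Algebra.Module.Properties.LeftModule as LeftModuleProperties
import Algebra.Properties.Ring as RingProperties
import Algebra.Properties.Semiring.Mult as SemiringMult
import Algebra.Solver.Ring as RingSolver
open import Algebra.Solver.Ring.AlmostCommutativeRing using (fromCommutativeRing; _-Raw-AlmostCommutative⟶_)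
open import Data.Empty using (⊥-elim)
open import Data.Fin.Base using (Fin; zero; suc; _↑ˡ_; _↑ʳ_)
open import Data.Fin.Patterns using (0F; 1F; 2F)
open import Data.Fin.Permutation using (Permutation′; permutation; _⟨$⟩ʳ_)
open import Data.Fin.Properties using (any?)
open import Data.Integer.Base using (ℤ; +_; -[1+_]; _⊖_)
import Data.Integer.Base as ℤ
import Data.Integer.Properties as ℤ
open import Data.Integer.Solver using (module +-*-Solver)
open import Data.List.Base using ([]; _∷_; _∷ʳ_)
open import Data.List.Properties using (foldr-∷ʳ)
open import Data.Maybe.Base using (map)
open import Data.Nat.Base using (ℕ; zero; suc; s≤s; z≤n)
import Data.Nat.Base as ℕ
open import Data.Nat.Induction using (<-wellFounded)
import Data.Nat.Properties as ℕ
open import Data.Product.Base using (∃; ∃-syntax; _×_; _,_; proj₁; proj₂)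
open import Data.Sum.Base using (_⊎_; inj₁; inj₂)
open import Data.Vec.Base as Vec using (Vec; []; _∷_; _++_; lookup)
open import Data.Vec.Functional as Vector using (Vector)
open import Data.Vec.Properties using (lookup-++ˡ; lookup-++ʳ; lookup-map)
open import Induction.WellFounded using (Acc; acc)
open import Relation.Binary.Consequences using (dec⇒weaklyDec)
open import Relation.Binary.Construct.Closure.ReflexiveTransitive using (Star; ε; _◅_)
open import Relation.Binary.PropositionalEquality as ≡ using (_≡_)
open import Relation.Binary.Rewriting using (IsNormalForm)
open import Relation.Binary.Structures using (IsDecTotalOrder)
open import Relation.Nullary.Decidable.Core using (Dec; yes; no; map′; from-no)
open import Relation.Nullary.Negation.Core using (¬_; contradiction)
open import Relation.Unary using (Pred; _∈_; _≐_)
open import Relation.Unary.Properties using (≐-refl; ≐-sym; ≐-trans)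

-- Arithmetic of the ordered field and the embedding of the integers.

module RealArithmetic {c ℓ₁ ℓ₂ : Level} (ℝ : RealNumbers c ℓ₁ ℓ₂) where
  open RealNumbers ℝ hiding (zero)
  open RingProperties ring
  open SemiringMult semiring using (×-homo-+; ×1-homo-*)
  open IsDecTotalOrder isDecTotalOrder public
    using (total; antisym; _≟_; ≤-respˡ-≈; ≤-respʳ-≈)
    renaming (reflexive to ≤-reflexive; trans to ≤-trans)
  open import Relation.Binary.Reasoning.Setoid setoid

  fromℤ-neg : ∀ i → fromℤ (ℤ.- i) ≈ - fromℤ i
  fromℤ-neg (+ zero)  = sym -0#≈0#
  fromℤ-neg (+ suc n) = refl
  fromℤ-neg -[1+ n ]  = sym (-‿involutive _)

  fromℤ-⊖ : ∀ m n → fromℤ (m ⊖ n) ≈ m ×ᴿ 1# - n ×ᴿ 1#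
  fromℤ-⊖ m       zero    = sym (trans (+-congˡ -0#≈0#) (+-identityʳ _))
  fromℤ-⊖ zero    (suc n) = sym (+-identityˡ _)
  fromℤ-⊖ (suc m) (suc n) = begin
    fromℤ (suc m ⊖ suc n)                    ≡⟨ ≡.cong fromℤ (ℤ.[1+m]⊖[1+n]≡m⊖n m n) ⟩
    fromℤ (m ⊖ n)                            ≈⟨ fromℤ-⊖ m n ⟩
    x - y                                    ≈⟨ +-congʳ (sym (+-identityˡ x)) ⟩
    0# + x - y                               ≈⟨ +-congʳ (+-congʳ (sym (-‿inverseʳ 1#))) ⟩
    (1# - 1#) + x - y                        ≈⟨ +-congʳ (+-assoc _ _ _) ⟩
    1# + (- 1# + x) - y                      ≈⟨ +-congʳ (+-congˡ (+-comm _ _)) ⟩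
    1# + (x - 1#) - y                        ≈⟨ +-congʳ (sym (+-assoc _ _ _)) ⟩
    1# + x - 1# - y                          ≈⟨ +-assoc _ _ _ ⟩
    1# + x + (- 1# - y)                      ≈⟨ +-congˡ (-‿+-comm 1# y) ⟩
    1# + x - (1# + y)                        ∎
    where
    x = m ×ᴿ 1#
    y = n ×ᴿ 1#

  fromℤ-+ : ∀ i j → fromℤ (i ℤ.+ j) ≈ fromℤ i + fromℤ j
  fromℤ-+ (+ m)    (+ n)    = ×-homo-+ 1# m n
  fromℤ-+ (+ m)    -[1+ n ] = fromℤ-⊖ m (suc n)
  fromℤ-+ -[1+ m ] (+ n)    = trans (fromℤ-⊖ n (suc m)) (+-comm _ _)
  fromℤ-+ -[1+ m ] -[1+ n ] = begin
    - (suc (suc (m ℕ.+ n)) ×ᴿ 1#)         ≡⟨ ≡.cong (λ k → - (k ×ᴿ 1#)) (≡.sym (ℕ.+-suc (suc m) n)) ⟩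
    - ((suc m ℕ.+ suc n) ×ᴿ 1#)           ≈⟨ -‿cong (×-homo-+ 1# (suc m) (suc n)) ⟩
    - (suc m ×ᴿ 1# + suc n ×ᴿ 1#)         ≈⟨ sym (-‿+-comm _ _) ⟩
    - (suc m ×ᴿ 1#) - suc n ×ᴿ 1#         ∎

  private
    fromℤ-*⁺ : ∀ i n → fromℤ (i ℤ.* + n) ≈ fromℤ i * fromℤ (+ n)
    fromℤ-*⁺ (+ m)    n = trans (reflexive (≡.cong fromℤ (≡.sym (ℤ.pos-* m n)))) (×1-homo-* m n)
    fromℤ-*⁺ -[1+ m ] n = begin
      fromℤ (-[1+ m ] ℤ.* + n)          ≡⟨ ≡.cong fromℤ (≡.sym (ℤ.neg-distribˡ-* (+ suc m) (+ n))) ⟩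
      fromℤ (ℤ.- (+ suc m ℤ.* + n))     ≈⟨ fromℤ-neg (+ suc m ℤ.* + n) ⟩
      - fromℤ (+ suc m ℤ.* + n)         ≈⟨ -‿cong (fromℤ-*⁺ (+ suc m) n) ⟩
      - (fromℤ (+ suc m) * fromℤ (+ n)) ≈⟨ -‿distribˡ-* _ _ ⟩
      fromℤ -[1+ m ] * fromℤ (+ n)      ∎

  fromℤ-* : ∀ i j → fromℤ (i ℤ.* j) ≈ fromℤ i * fromℤ j
  fromℤ-* i (+ n)    = fromℤ-*⁺ i n
  fromℤ-* i -[1+ n ] = begin
    fromℤ (i ℤ.* -[1+ n ])          ≡⟨ ≡.cong fromℤ (≡.sym (ℤ.neg-distribʳ-* i (+ suc n))) ⟩
    fromℤ (ℤ.- (i ℤ.* + suc n))     ≈⟨ fromℤ-neg (i ℤ.* + suc n) ⟩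
    - fromℤ (i ℤ.* + suc n)         ≈⟨ -‿cong (fromℤ-*⁺ i (suc n)) ⟩
    - (fromℤ i * fromℤ (+ suc n))   ≈⟨ -‿distribʳ-* _ _ ⟩
    fromℤ i * fromℤ -[1+ n ]        ∎

  fromℤ-1 : fromℤ (+ 1) ≈ 1#
  fromℤ-1 = +-identityʳ 1#

  fromℤ-morphism : ℤ.+-*-rawRing -Raw-AlmostCommutative⟶ fromCommutativeRing commutativeRing
  fromℤ-morphism = record
    { ⟦_⟧    = fromℤ
    ; +-homo = fromℤ-+
    ; *-homo = fromℤ-*
    ; -‿homo = fromℤ-neg
    ; 0-homo = refl
    ; 1-homo = fromℤ-1
    }

  -- Coefficients are taken in ℤ, where equality is decided by computation, so the solver can
  -- calculate with numerals such as `fromℤ (+ 2)`.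
  module Solver = RingSolver ℤ.+-*-rawRing (fromCommutativeRing commutativeRing) fromℤ-morphism
    (λ i j → map (λ i≡j → reflexive (≡.cong fromℤ i≡j)) (dec⇒weaklyDec ℤ._≟_ i j))
  open Solver hiding (⟦_⟧)

  x-y≈0⇒x≈y : ∀ {x y} → x - y ≈ 0# → x ≈ y
  x-y≈0⇒x≈y {x} {y} eq = begin
    x         ≈⟨ solve 2 (λ x y → x := (x :- y) :+ y) refl x y ⟩
    x - y + y ≈⟨ +-congʳ eq ⟩
    0# + y    ≈⟨ +-identityˡ y ⟩
    y         ∎

  x*y≈0⇒x≈0 : ∀ {x y} → ¬ y ≈ 0# → x * y ≈ 0# → x ≈ 0#
  x*y≈0⇒x≈0 {x} {y} y≉0 xy≈0 = begin
    x              ≈⟨ sym (*-identityʳ x) ⟩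
    x * 1#         ≈⟨ *-congˡ (sym (⁻¹-inverse y≉0)) ⟩
    x * (y * y ⁻¹) ≈⟨ sym (*-assoc x y (y ⁻¹)) ⟩
    x * y * y ⁻¹   ≈⟨ *-congʳ xy≈0 ⟩
    0# * y ⁻¹      ≈⟨ zeroˡ _ ⟩
    0#             ∎

  *-cancelʳ : ∀ {x y z} → ¬ z ≈ 0# → x * z ≈ y * z → x ≈ y
  *-cancelʳ {x} {y} {z} z≉0 eq = x-y≈0⇒x≈y (x*y≈0⇒x≈0 z≉0 (begin
    (x - y) * z   ≈⟨ solve 3 (λ x y z → (x :- y) :* z := x :* z :- y :* z) refl x y z ⟩
    x * z - y * z ≈⟨ +-congʳ eq ⟩
    y * z - y * z ≈⟨ -‿inverseʳ _ ⟩
    0#            ∎))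

  Positive : Carrier → Set _
  Positive x = 0# ≤ x × ¬ x ≈ 0#

  Positive-resp : ∀ {x y} → x ≈ y → Positive x → Positive y
  Positive-resp x≈y (0≤x , x≉0) = ≤-respʳ-≈ x≈y 0≤x , λ y≈0 → x≉0 (trans x≈y y≈0)

  +-nonNegative : ∀ {x y} → 0# ≤ x → 0# ≤ y → 0# ≤ x + y
  +-nonNegative {x} {y} 0≤x 0≤y = ≤-trans 0≤y (≤-respˡ-≈ (+-identityˡ y) (+-monoˡ-≤ y 0≤x))

  0≤-x⇒x≤0 : ∀ {x} → 0# ≤ - x → x ≤ 0#
  0≤-x⇒x≤0 {x} p = ≤-respʳ-≈ (-‿inverseˡ x) (≤-respˡ-≈ (+-identityˡ x) (+-monoˡ-≤ x p))

  Positive-* : ∀ {x y} → Positive x → Positive y → Positive (x * y)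
  Positive-* (0≤x , x≉0) (0≤y , y≉0) = *-nonNegative 0≤x 0≤y , λ xy≈0 → x≉0 (x*y≈0⇒x≈0 y≉0 xy≈0)

  ¬Positive-neg : ∀ {x} → Positive x → ¬ 0# ≤ - x
  ¬Positive-neg (0≤x , x≉0) 0≤-x = x≉0 (antisym (0≤-x⇒x≤0 0≤-x) 0≤x)

  -- If instead 1 ≤ 0, then -1 is nonnegative, and hence so is its square, which is 1.
  0≤1 : 0# ≤ 1#
  0≤1 with total 0# 1#
  ... | inj₁ 0≤1 = 0≤1
  ... | inj₂ 1≤0 = ≤-respʳ-≈ square (*-nonNegative 0≤-1 0≤-1)
    where
    0≤-1 : 0# ≤ - 1#
    0≤-1 = ≤-respʳ-≈ (+-identityˡ _) (≤-respˡ-≈ (-‿inverseʳ 1#) (+-monoˡ-≤ (- 1#) 1≤0))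
    square : - 1# * - 1# ≈ 1#
    square = trans (solve 1 (λ x → (:- x) :* (:- x) := x :* x) refl 1#) (*-identityˡ 1#)

  fromℕ-nonNegative : ∀ n → 0# ≤ fromℤ (+ n)
  fromℕ-nonNegative zero    = ≤-reflexive refl
  fromℕ-nonNegative (suc n) = +-nonNegative 0≤1 (fromℕ-nonNegative n)

  Positive-fromℕ : ∀ n → Positive (fromℤ (+ suc n))
  Positive-fromℕ n = fromℕ-nonNegative (suc n) , λ eq → 0≉1 (antisym 0≤1 (1≤0 eq))
    where
    1≤0 : 1# + fromℤ (+ n) ≈ 0# → 1# ≤ 0#
    1≤0 eq = ≤-respʳ-≈ (trans (+-comm _ _) eq) (≤-respˡ-≈ (+-identityˡ 1#) (+-monoˡ-≤ 1# (fromℕ-nonNegative n)))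

  fromℤ≈0⇒≡0 : ∀ i → fromℤ i ≈ 0# → i ≡ + 0
  fromℤ≈0⇒≡0 (+ zero)  _  = ≡.refl
  fromℤ≈0⇒≡0 (+ suc n) eq = ⊥-elim (proj₂ (Positive-fromℕ n) eq)
  fromℤ≈0⇒≡0 -[1+ n ]  eq = ⊥-elim (proj₂ (Positive-fromℕ n) (-‿injective (trans eq (sym -0#≈0#))))

  -- An ordered field has characteristic zero. This turns identities between real pairings into
  -- identities between integer coordinates.
  fromℤ-injective : ∀ {i j} → fromℤ i ≈ fromℤ j → i ≡ j
  fromℤ-injective {i} {j} eq = ℤ.i-j≡0⇒i≡j i j (fromℤ≈0⇒≡0 (i ℤ.- j) (begin
    fromℤ (i ℤ.- j)         ≈⟨ fromℤ-+ i (ℤ.- j) ⟩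
    fromℤ i + fromℤ (ℤ.- j) ≈⟨ +-cong eq (fromℤ-neg j) ⟩
    fromℤ j - fromℤ j       ≈⟨ -‿inverseʳ _ ⟩
    0#                      ∎))


-- Inner product spaces: vector identities and equality.

module EuclideanGeometry {c ℓ₁ ℓ₂ m ℓm : Level} {ℝ : RealNumbers c ℓ₁ ℓ₂}
                         (V : InnerProductSpace ℝ m ℓm) where
  open RealNumbers ℝ hiding (zero)
  open RealArithmetic ℝ
  open RingProperties ring
  open InnerProductSpace V
  open Module vectorSpace using
    (≈ᴹ-refl; ≈ᴹ-sym; ≈ᴹ-trans; +ᴹ-cong; -ᴹ‿cong; -ᴹ‿inverseʳ; *ₗ-cong; *ₗ-zeroˡ; *ₗ-distribʳ; leftModule)
  open LeftModuleProperties leftModule using (inverseˡ-uniqueᴹ; -ᴹ-involutive)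
  open Solver using (Polynomial; con; var; :-_; _:+_; _:-_; _:*_; _:=_; solve; prove; ⟦_⟧; ⟦_⟧↓)
  open import Relation.Binary.Reasoning.Setoid setoid

  ⟨⟩-zeroˡ : ∀ v → ⟨ 0ᴹ , v ⟩ ≈ 0#
  ⟨⟩-zeroˡ v = begin
    ⟨ 0ᴹ , v ⟩       ≈⟨ ⟨⟩-cong (≈ᴹ-sym (*ₗ-zeroˡ v)) ≈ᴹ-refl ⟩
    ⟨ 0# *ₗ v , v ⟩  ≈⟨ ⟨⟩-scalar 0# v v ⟩
    0# * ⟨ v , v ⟩   ≈⟨ zeroˡ _ ⟩
    0#               ∎

  ⟨⟩-negˡ : ∀ u v → ⟨ -ᴹ u , v ⟩ ≈ - ⟨ u , v ⟩
  ⟨⟩-negˡ u v = +-inverseʳ-unique ⟨ u , v ⟩ ⟨ -ᴹ u , v ⟩ (begin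
    ⟨ u , v ⟩ + ⟨ -ᴹ u , v ⟩ ≈⟨ sym (⟨⟩-additive u (-ᴹ u) v) ⟩
    ⟨ u +ᴹ -ᴹ u , v ⟩        ≈⟨ ⟨⟩-cong (-ᴹ‿inverseʳ u) ≈ᴹ-refl ⟩
    ⟨ 0ᴹ , v ⟩               ≈⟨ ⟨⟩-zeroˡ v ⟩
    0#                       ∎)

  x-y≈0⇒x≈yᴹ : ∀ {x y} → x +ᴹ -ᴹ y ≈ᴹ 0ᴹ → x ≈ᴹ y
  x-y≈0⇒x≈yᴹ {x} {y} eq = ≈ᴹ-trans (inverseˡ-uniqueᴹ x (-ᴹ y) eq) (-ᴹ-involutive y)

  -- Taking z = x - y shows that x - y has norm 0.
  ⟨⟩-nonDegenerate : ∀ {x y} → (∀ z → ⟨ x , z ⟩ ≈ ⟨ y , z ⟩) → x ≈ᴹ y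
  ⟨⟩-nonDegenerate {x} {y} eq = x-y≈0⇒x≈yᴹ (⟨⟩-definite _ norm≈0)
    where
    norm≈0 : ⟨ x +ᴹ -ᴹ y , x +ᴹ -ᴹ y ⟩ ≈ 0#
    norm≈0 = trans (⟨⟩-additive x (-ᴹ y) _) (trans (+-cong (eq _) (⟨⟩-negˡ y _)) (-‿inverseʳ _))

  2x≈2y⇒x≈y : ∀ {x y} → fromℤ (+ 2) *ₗ x ≈ᴹ fromℤ (+ 2) *ₗ y → x ≈ᴹ y
  2x≈2y⇒x≈y {x} {y} eq = ⟨⟩-nonDegenerate λ z → *-cancelʳ (proj₂ (Positive-fromℕ 1)) (begin
    ⟨ x , z ⟩ * fromℤ (+ 2)      ≈⟨ *-comm _ _ ⟩
    fromℤ (+ 2) * ⟨ x , z ⟩      ≈⟨ sym (⟨⟩-scalar _ x z) ⟩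
    ⟨ fromℤ (+ 2) *ₗ x , z ⟩     ≈⟨ ⟨⟩-cong eq ≈ᴹ-refl ⟩
    ⟨ fromℤ (+ 2) *ₗ y , z ⟩     ≈⟨ ⟨⟩-scalar _ y z ⟩
    fromℤ (+ 2) * ⟨ y , z ⟩      ≈⟨ *-comm _ _ ⟩
    ⟨ y , z ⟩ * fromℤ (+ 2)      ∎)

  infix 4 _≟ᴹ_
  _≟ᴹ_ : ∀ u v → Dec (u ≈ᴹ v)
  u ≟ᴹ v = map′ (λ eq → x-y≈0⇒x≈yᴹ (⟨⟩-definite _ eq)) u≈v⇒norm≈0 (⟨ u +ᴹ -ᴹ v , u +ᴹ -ᴹ v ⟩ ≟ 0#)
    where
    u≈v⇒norm≈0 : u ≈ᴹ v → ⟨ u +ᴹ -ᴹ v , u +ᴹ -ᴹ v ⟩ ≈ 0#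
    u≈v⇒norm≈0 u≈v = trans (⟨⟩-cong (≈ᴹ-trans (+ᴹ-cong u≈v ≈ᴹ-refl) (-ᴹ‿inverseʳ v)) ≈ᴹ-refl) (⟨⟩-zeroˡ _)

  -- Repetitions are removed so that a reflection, which permutes the roots as vectors, also
  -- permutes their indices.
  distinct-enumeration : ∀ {n} (f : Vector Carrierᴹ n) →
    ∃[ k ] ∃ λ (g : Vector Carrierᴹ k) →
      (∀ {i j} → g i ≈ᴹ g j → i ≡ j) × (∀ i → ∃[ j ] f i ≈ᴹ g j) × (∀ j → ∃[ i ] g j ≈ᴹ f i)
  distinct-enumeration {zero}  f = 0 , f , (λ { {()} }) , (λ ()) , (λ ())
  distinct-enumeration {suc n} f with distinct-enumeration (λ i → f (suc i))
  ... | k , g , g-injective , f⊆g , g⊆f with any? (λ j → f zero ≟ᴹ g j)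
  ...   | yes f₀∈g = k , g , g-injective , (λ { zero → f₀∈g ; (suc i) → f⊆g i }) ,
                     (λ j → let i , eq = g⊆f j in suc i , eq)
  ...   | no  f₀∉g = suc k , f zero Vector.∷ g , injective ,
                     (λ { zero → zero , ≈ᴹ-refl ; (suc i) → let j , eq = f⊆g i in suc j , eq }) ,
                     (λ { zero → zero , ≈ᴹ-refl ; (suc j) → let i , eq = g⊆f j in suc i , eq })
    where
    injective : ∀ {i j} → (f zero Vector.∷ g) i ≈ᴹ (f zero Vector.∷ g) j → i ≡ j
    injective {zero}  {zero}  _  = ≡.refl
    injective {zero}  {suc j} eq = ⊥-elim (f₀∉g (j , eq))
    injective {suc i} {zero}  eq = ⊥-elim (f₀∉g (i , ≈ᴹ-sym eq))
    injective {suc i} {suc j} eq = ≡.cong suc (g-injective eq)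

  ⊥-sym : ∀ {u v} → u ⊥ v → v ⊥ u
  ⊥-sym u⊥v = trans (⟨⟩-sym _ _) u⊥v

  ⊥-+ : ∀ {x y z} → x ⊥ z → y ⊥ z → (x +ᴹ y) ⊥ z
  ⊥-+ {x} {y} {z} x⊥z y⊥z = trans (⟨⟩-additive x y z) (trans (+-cong x⊥z y⊥z) (+-identityˡ 0#))

  ⊥-neg : ∀ {u v} → u ⊥ v → u ⊥ (-ᴹ v)
  ⊥-neg {u} {v} u⊥v = ⊥-sym (trans (⟨⟩-negˡ v u) (trans (-‿cong (⊥-sym u⊥v)) -0#≈0#))

  Positive-norm : ∀ {u} → ¬ u ≈ᴹ 0ᴹ → Positive ⟨ u , u ⟩
  Positive-norm {u} u≉0 = ⟨⟩-nonNeg u , λ eq → u≉0 (⟨⟩-definite u eq)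

  -- Vector identities are decided by pairing both sides with an arbitrary z,
  -- which turns them into ring identities.
  infixl 6 _⊕_
  infixr 7 _⊙_ _⊛_
  infix  8 ⊖_

  data Expr (s k : ℕ) : Set where
    vec : Fin k → Expr s k
    _⊕_ : Expr s k → Expr s k → Expr s k
    ⊖_  : Expr s k → Expr s k
    _⊙_ : Fin s → Expr s k → Expr s k
    _⊛_ : ℤ → Expr s k → Expr s k

  module _ {s k : ℕ} where
    ⟦_⟧ᵛ : Expr s k → Vec Carrier s → Vec Carrierᴹ k → Carrierᴹ
    ⟦ vec i ⟧ᵛ   ρ σ = lookup σ i
    ⟦ e ⊕ e′ ⟧ᵛ  ρ σ = ⟦ e ⟧ᵛ ρ σ +ᴹ ⟦ e′ ⟧ᵛ ρ σ
    ⟦ ⊖ e ⟧ᵛ     ρ σ = -ᴹ ⟦ e ⟧ᵛ ρ σ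
    ⟦ j ⊙ e ⟧ᵛ   ρ σ = lookup ρ j *ₗ ⟦ e ⟧ᵛ ρ σ
    ⟦ i ⊛ e ⟧ᵛ   ρ σ = fromℤ i *ₗ ⟦ e ⟧ᵛ ρ σ

    inner : Expr s k → Polynomial (s ℕ.+ k)
    inner (vec i)  = var (s ↑ʳ i)
    inner (e ⊕ e′) = inner e :+ inner e′
    inner (⊖ e)    = :- inner e
    inner (j ⊙ e)  = var (j ↑ˡ k) :* inner e
    inner (i ⊛ e)  = con i :* inner e

    private
      env : Vec Carrier s → Vec Carrierᴹ k → Carrierᴹ → Vec Carrier (s ℕ.+ k)
      env ρ σ z = ρ ++ Vec.map (λ v → ⟨ v , z ⟩) σ

    inner-correct : ∀ e ρ σ z → ⟨ ⟦ e ⟧ᵛ ρ σ , z ⟩ ≈ ⟦ inner e ⟧ (env ρ σ z)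
    inner-correct (vec i)  ρ σ z = sym (reflexive (≡.trans (lookup-++ʳ ρ (Vec.map (λ v → ⟨ v , z ⟩) σ) i) (lookup-map i _ σ)))
    inner-correct (e ⊕ e′) ρ σ z = trans (⟨⟩-additive _ _ z) (+-cong (inner-correct e ρ σ z) (inner-correct e′ ρ σ z))
    inner-correct (⊖ e)    ρ σ z = trans (⟨⟩-negˡ _ z) (-‿cong (inner-correct e ρ σ z))
    inner-correct (j ⊙ e)  ρ σ z = trans (⟨⟩-scalar _ _ z)
      (*-cong (sym (reflexive (lookup-++ˡ ρ (Vec.map (λ v → ⟨ v , z ⟩) σ) j))) (inner-correct e ρ σ z))
    inner-correct (i ⊛ e)  ρ σ z = trans (⟨⟩-scalar _ _ z) (*-congˡ (inner-correct e ρ σ z))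

    solveᵛ : ∀ (ρ : Vec Carrier s) (σ : Vec Carrierᴹ k) e e′ →
             (∀ z → ⟦ inner e ⟧↓ (env ρ σ z) ≈ ⟦ inner e′ ⟧↓ (env ρ σ z)) →
             ⟦ e ⟧ᵛ ρ σ ≈ᴹ ⟦ e′ ⟧ᵛ ρ σ
    solveᵛ ρ σ e e′ eq = ⟨⟩-nonDegenerate λ z → begin
      ⟨ ⟦ e ⟧ᵛ ρ σ , z ⟩         ≈⟨ inner-correct e ρ σ z ⟩
      ⟦ inner e ⟧ (env ρ σ z)    ≈⟨ prove (env ρ σ z) (inner e) (inner e′) (eq z) ⟩
      ⟦ inner e′ ⟧ (env ρ σ z)   ≈⟨ sym (inner-correct e′ ρ σ z) ⟩
      ⟨ ⟦ e′ ⟧ᵛ ρ σ , z ⟩        ∎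

  -- Coroot pairings and reflections.

  pairing : Carrierᴹ → Carrierᴹ → Carrier
  pairing u α = ⟨ u , coroot α ⟩

  scale : Carrierᴹ → Carrier
  scale α = (1# + 1#) * ⟨ α , α ⟩ ⁻¹

  two : 1# + 1# ≈ fromℤ (+ 2)
  two = +-congˡ (sym (+-identityʳ 1#))

  pairing-scale : ∀ u α → pairing u α ≈ scale α * ⟨ u , α ⟩
  pairing-scale u α = trans (⟨⟩-sym u _) (trans (⟨⟩-scalar _ α u) (*-congˡ (⟨⟩-sym α u)))

  scale-cong : ∀ {α β} → ⟨ α , α ⟩ ≈ ⟨ β , β ⟩ → scale α ≈ scale β
  scale-cong eq = *-congˡ (⁻¹-cong eq)

  coroot-cong : ∀ {α β} → α ≈ᴹ β → coroot α ≈ᴹ coroot β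
  coroot-cong eq = *ₗ-cong (scale-cong (⟨⟩-cong eq eq)) eq

  pairing-cong : ∀ {u v α β} → u ≈ᴹ v → α ≈ᴹ β → pairing u α ≈ pairing v β
  pairing-cong u≈v α≈β = ⟨⟩-cong u≈v (coroot-cong α≈β)

  reflect-cong : ∀ {α β u v} → α ≈ᴹ β → u ≈ᴹ v → reflect α u ≈ᴹ reflect β v
  reflect-cong α≈β u≈v = +ᴹ-cong u≈v (-ᴹ‿cong (*ₗ-cong (pairing-cong u≈v α≈β) α≈β))

  reflect-by : ∀ {α u x} → pairing u α ≈ x → reflect α u ≈ᴹ u +ᴹ -ᴹ (x *ₗ α)
  reflect-by eq = +ᴹ-cong ≈ᴹ-refl (-ᴹ‿cong (*ₗ-cong eq ≈ᴹ-refl))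

  pairing-negˡ : ∀ u α → pairing (-ᴹ u) α ≈ - pairing u α
  pairing-negˡ u α = ⟨⟩-negˡ u (coroot α)

  reflect-+ : ∀ α u v → reflect α (u +ᴹ v) ≈ᴹ reflect α u +ᴹ reflect α v
  reflect-+ α u v = ≈ᴹ-trans
    (reflect-by {α} {u +ᴹ v} (⟨⟩-additive u v (coroot α)))
    (≈ᴹ-trans (+ᴹ-cong ≈ᴹ-refl (-ᴹ‿cong (*ₗ-distribʳ α a b)))
      (solveᵛ (a ∷ b ∷ []) (u ∷ v ∷ α ∷ [])
        (vec 0F ⊕ vec 1F ⊕ ⊖ (0F ⊙ vec 2F ⊕ 1F ⊙ vec 2F))
        ((vec 0F ⊕ ⊖ (0F ⊙ vec 2F)) ⊕ (vec 1F ⊕ ⊖ (1F ⊙ vec 2F)))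
        (λ _ → refl)))
    where
    a = pairing u α
    b = pairing v α

  *ₗ-negˡ : ∀ a u → (- a) *ₗ u ≈ᴹ -ᴹ (a *ₗ u)
  *ₗ-negˡ a u = ⟨⟩-nonDegenerate λ z → begin
    ⟨ (- a) *ₗ u , z ⟩   ≈⟨ ⟨⟩-scalar (- a) u z ⟩
    - a * ⟨ u , z ⟩      ≈⟨ sym (-‿distribˡ-* a ⟨ u , z ⟩) ⟩
    - (a * ⟨ u , z ⟩)    ≈⟨ -‿cong (sym (⟨⟩-scalar a u z)) ⟩
    - ⟨ a *ₗ u , z ⟩     ≈⟨ sym (⟨⟩-negˡ _ z) ⟩
    ⟨ -ᴹ (a *ₗ u) , z ⟩  ∎

  ⟨reflect,⟩ : ∀ α u z → ⟨ reflect α u , z ⟩ ≈ ⟨ u , z ⟩ - pairing u α * ⟨ α , z ⟩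
  ⟨reflect,⟩ α u z = trans (⟨⟩-additive u _ z) (+-congˡ (trans (⟨⟩-negˡ _ z) (-‿cong (⟨⟩-scalar _ α z))))

  -- Repeated use evaluates the pairings of iterated reflections of roots by integer computation
  -- alone.
  pairing-reflectˡ : ∀ {u α β i j k} → pairing u β ≈ fromℤ i → pairing u α ≈ fromℤ j → pairing α β ≈ fromℤ k →
                     pairing (reflect α u) β ≈ fromℤ (i ℤ.- j ℤ.* k)
  pairing-reflectˡ {u} {α} {β} {i} {j} {k} uβ uα αβ = begin
    pairing (reflect α u) β                   ≈⟨ ⟨reflect,⟩ α u (coroot β) ⟩
    pairing u β - pairing u α * pairing α β   ≈⟨ +-cong uβ (-‿cong (*-cong uα αβ)) ⟩
    fromℤ i - fromℤ j * fromℤ k               ≈⟨ +-congˡ (-‿cong (sym (fromℤ-* j k))) ⟩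
    fromℤ i - fromℤ (j ℤ.* k)                 ≈⟨ +-congˡ (sym (fromℤ-neg (j ℤ.* k))) ⟩
    fromℤ i + fromℤ (ℤ.- (j ℤ.* k))           ≈⟨ sym (fromℤ-+ i (ℤ.- (j ℤ.* k))) ⟩
    fromℤ (i ℤ.- j ℤ.* k)                     ∎

  ⊥-reflect : ∀ {u α β} → u ⊥ α → u ⊥ β → u ⊥ reflect α β
  ⊥-reflect {u} {α} {β} u⊥α u⊥β = ⊥-sym (begin
    ⟨ reflect α β , u ⟩                    ≈⟨ ⟨reflect,⟩ α β u ⟩
    ⟨ β , u ⟩ - pairing β α * ⟨ α , u ⟩    ≈⟨ +-cong (⊥-sym u⊥β) (-‿cong (*-congˡ (⊥-sym u⊥α))) ⟩
    0# - pairing β α * 0#                  ≈⟨ solve 1 (λ x → con (+ 0) :- x :* con (+ 0) := con (+ 0)) refl _ ⟩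
    0#                                     ∎)

  module _ {α : Carrierᴹ} (α≉0 : ¬ α ≈ᴹ 0ᴹ) where
    private
      N = ⟨ α , α ⟩
      k = scale α

    norm≉0 : ¬ N ≈ 0#
    norm≉0 eq = α≉0 (⟨⟩-definite α eq)

    scale-norm : k * N ≈ fromℤ (+ 2)
    scale-norm = begin
      (1# + 1#) * N ⁻¹ * N    ≈⟨ *-assoc _ _ _ ⟩
      (1# + 1#) * (N ⁻¹ * N)  ≈⟨ *-cong two (trans (*-comm _ _) (⁻¹-inverse norm≉0)) ⟩
      fromℤ (+ 2) * 1#        ≈⟨ *-identityʳ _ ⟩
      fromℤ (+ 2)             ∎

    pairing-norm : ∀ u → pairing u α * N ≈ fromℤ (+ 2) * ⟨ u , α ⟩
    pairing-norm u = begin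
      pairing u α * N           ≈⟨ *-congʳ (pairing-scale u α) ⟩
      k * ⟨ u , α ⟩ * N         ≈⟨ solve 3 (λ k a n → k :* a :* n := (k :* n) :* a) refl k ⟨ u , α ⟩ N ⟩
      k * N * ⟨ u , α ⟩         ≈⟨ *-congʳ scale-norm ⟩
      fromℤ (+ 2) * ⟨ u , α ⟩   ∎

    pairing-self : pairing α α ≈ fromℤ (+ 2)
    pairing-self = trans (pairing-scale α α) scale-norm

    ⊥⇒pairing≈0 : ∀ {u} → u ⊥ α → pairing u α ≈ 0#
    ⊥⇒pairing≈0 {u} u⊥α = trans (pairing-scale u α) (trans (*-congˡ u⊥α) (zeroʳ _))

    pairing≈0⇒⊥ : ∀ {u} → pairing u α ≈ 0# → u ⊥ α
    pairing≈0⇒⊥ {u} eq = x*y≈0⇒x≈0 (proj₂ (Positive-fromℕ 1)) (begin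
      ⟨ u , α ⟩ * fromℤ (+ 2)  ≈⟨ *-comm _ _ ⟩
      fromℤ (+ 2) * ⟨ u , α ⟩  ≈⟨ sym (pairing-norm u) ⟩
      pairing u α * N          ≈⟨ *-congʳ eq ⟩
      0# * N                   ≈⟨ zeroˡ N ⟩
      0#                       ∎)

    reflect-self : reflect α α ≈ᴹ -ᴹ α
    reflect-self = ≈ᴹ-trans (reflect-by {α} {α} pairing-self)
      (solveᵛ [] (α ∷ []) (vec 0F ⊕ ⊖ (+ 2 ⊛ vec 0F)) (⊖ vec 0F) (λ _ → refl))

    reflect-fix : ∀ {u} → u ⊥ α → reflect α u ≈ᴹ u
    reflect-fix {u} u⊥α = ≈ᴹ-trans (reflect-by {α} {u} (⊥⇒pairing≈0 u⊥α))
      (solveᵛ [] (u ∷ α ∷ []) (vec 0F ⊕ ⊖ (+ 0 ⊛ vec 1F)) (vec 0F) (λ _ → refl))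

    reflect-involutive : ∀ u → reflect α (reflect α u) ≈ᴹ u
    reflect-involutive u = ≈ᴹ-trans (+ᴹ-cong ≈ᴹ-refl (-ᴹ‿cong (≈ᴹ-trans (*ₗ-cong pairing-reflect ≈ᴹ-refl) (*ₗ-negˡ n α))))
      (solveᵛ (n ∷ []) (u ∷ α ∷ []) (vec 0F ⊕ ⊖ (0F ⊙ vec 1F) ⊕ ⊖ ⊖ (0F ⊙ vec 1F)) (vec 0F) (λ _ → refl))
      where
      n = pairing u α
      pairing-reflect : pairing (reflect α u) α ≈ - n
      pairing-reflect = begin
        pairing (reflect α u) α        ≈⟨ ⟨reflect,⟩ α u (coroot α) ⟩
        n - n * pairing α α            ≈⟨ +-congˡ (-‿cong (*-congˡ pairing-self)) ⟩
        n - n * fromℤ (+ 2)            ≈⟨ solve 1 (λ n → n :- n :* con (+ 2) := :- n) refl n ⟩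
        - n                            ∎

    -- The term subtracted is a multiple of ⟨u, α⟩⟨v, α⟩, which is symmetric in `u` and `v`.
    reflect-selfAdjoint : ∀ u v → ⟨ reflect α u , v ⟩ ≈ ⟨ u , reflect α v ⟩
    reflect-selfAdjoint u v = begin
      ⟨ reflect α u , v ⟩                           ≈⟨ ⟨reflect,⟩ α u v ⟩
      ⟨ u , v ⟩ - pairing u α * ⟨ α , v ⟩
        ≈⟨ +-cong (⟨⟩-sym u v) (-‿cong (*-cong (pairing-scale u α) (⟨⟩-sym α v))) ⟩
      ⟨ v , u ⟩ - (k * ⟨ u , α ⟩) * ⟨ v , α ⟩
        ≈⟨ solve 4 (λ x k a b → x :- k :* a :* b := x :- k :* b :* a) refl ⟨ v , u ⟩ k ⟨ u , α ⟩ ⟨ v , α ⟩ ⟩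
      ⟨ v , u ⟩ - (k * ⟨ v , α ⟩) * ⟨ u , α ⟩
        ≈⟨ +-congˡ (-‿cong (*-cong (sym (pairing-scale v α)) (⟨⟩-sym u α))) ⟩
      ⟨ v , u ⟩ - pairing v α * ⟨ α , u ⟩           ≈⟨ sym (⟨reflect,⟩ α v u) ⟩
      ⟨ reflect α v , u ⟩                           ≈⟨ ⟨⟩-sym _ u ⟩
      ⟨ u , reflect α v ⟩                           ∎

    reflect-isometry : ∀ u v → ⟨ reflect α u , reflect α v ⟩ ≈ ⟨ u , v ⟩
    reflect-isometry u v = trans (reflect-selfAdjoint u (reflect α v)) (⟨⟩-cong ≈ᴹ-refl (reflect-involutive v))

    -- A reflection preserves norms, so the factor `scale` is the same for `β` and its image;
    -- self-adjointness then moves the reflection to the other side.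
    pairing-reflectʳ : ∀ u β → pairing u (reflect α β) ≈ pairing (reflect α u) β
    pairing-reflectʳ u β = begin
      pairing u (reflect α β)                      ≈⟨ pairing-scale u (reflect α β) ⟩
      scale (reflect α β) * ⟨ u , reflect α β ⟩
        ≈⟨ *-cong (scale-cong (reflect-isometry β β)) (sym (reflect-selfAdjoint u β)) ⟩
      scale β * ⟨ reflect α u , β ⟩                ≈⟨ sym (pairing-scale (reflect α u) β) ⟩
      pairing (reflect α u) β                      ∎

-- Weyl orbits and roots orthogonal to a point.

module WeylOrbits {c ℓ₁ ℓ₂ m ℓm : Level} {ℝ : RealNumbers c ℓ₁ ℓ₂}
                  {V : InnerProductSpace ℝ m ℓm} (R : RootSystem V) where
  open RealNumbers ℝ hiding (zero)
  open RealArithmetic ℝ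
  open InnerProductSpace V
  open Module vectorSpace using (≈ᴹ-refl; ≈ᴹ-sym; ≈ᴹ-trans; +ᴹ-cong)
  open EuclideanGeometry V
  open RootSystem R

  infix 4 _∼_
  _∼_ : Carrierᴹ → Carrierᴹ → Set _
  u ∼ v = orbit u ≐ orbit v

  Φ-resp-≈ : ∀ {α β} → α ≈ᴹ β → α ∈ Φ → β ∈ Φ
  Φ-resp-≈ α≈β (i , α≈rᵢ) = i , ≈ᴹ-trans (≈ᴹ-sym α≈β) α≈rᵢ

  root∈Φ : ∀ i → root i ∈ Φ
  root∈Φ i = i , ≈ᴹ-refl

  Φ-neg : ∀ {α} → α ∈ Φ → -ᴹ α ∈ Φ
  Φ-neg α∈Φ = Φ-resp-≈ (reflect-self (nonZero α∈Φ)) (reflectionClosed α∈Φ α∈Φ)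

  act-cong : ∀ w {u v} → u ≈ᴹ v → act w u ≈ᴹ act w v
  act-cong []      eq = eq
  act-cong (i ∷ w) eq = reflect-cong ≈ᴹ-refl (act-cong w eq)

  ≈⇒∼ : ∀ {u v} → u ≈ᴹ v → u ∼ v
  ≈⇒∼ eq = (λ (w , p) → w , ≈ᴹ-trans p (act-cong w eq)) , (λ (w , p) → w , ≈ᴹ-trans p (act-cong w (≈ᴹ-sym eq)))

  private
    orbit-reflect-⊆ : ∀ i {u u′} → u′ ∈ orbit (reflect (root i) u) → u′ ∈ orbit u
    orbit-reflect-⊆ i {u} (w , p) rewrite ≡.sym (foldr-∷ʳ (λ j → reflect (root j)) u i w) = w ∷ʳ i , p

  -- Appending `i` to a word gives one inclusion of orbits. The other is the same inclusion at the
  -- reflected point, since the reflection is an involution.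
  reflect-∼ : ∀ {α} → α ∈ Φ → ∀ u → reflect α u ∼ u
  reflect-∼ {α} (i , α≈rᵢ) u = ≐-trans (≈⇒∼ (reflect-cong α≈rᵢ ≈ᴹ-refl))
    ( orbit-reflect-⊆ i
    , λ p → orbit-reflect-⊆ i (proj₂ (≈⇒∼ (reflect-involutive (nonZero (root∈Φ i)) u)) p) )

  -- The reflection in `α` fixes `u`, so by additivity it acts on the summand `x` alone.
  reflect-summand-∼ : ∀ {α u} → α ∈ Φ → u ⊥ α → ∀ x → u +ᴹ x ∼ u +ᴹ reflect α x
  reflect-summand-∼ {α} {u} α∈Φ u⊥α x = ≐-trans (≐-sym (reflect-∼ α∈Φ (u +ᴹ x)))
    (≈⇒∼ (≈ᴹ-trans (reflect-+ α u x) (+ᴹ-cong (reflect-fix (nonZero α∈Φ) u⊥α) ≈ᴹ-refl)))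

  neg-summand-∼ : ∀ {α u} → α ∈ Φ → u ⊥ α → u +ᴹ α ∼ u +ᴹ -ᴹ α
  neg-summand-∼ {α} α∈Φ u⊥α = ≐-trans (reflect-summand-∼ α∈Φ u⊥α α)
    (≈⇒∼ (+ᴹ-cong ≈ᴹ-refl (reflect-self (nonZero α∈Φ))))

  -- A move may start at any representative `x` of the orbit. Undoing the word `w` one reflection at
  -- a time carries `x` to `u` and, by isometry, the root `α` to a root orthogonal to `u`.
  orthogonal-root-transport : ∀ w {u x α} → x ≈ᴹ act w u → α ∈ Φ → x ⊥ α →
                              ∃[ β ] (β ∈ Φ × u ⊥ β × x +ᴹ α ∼ u +ᴹ β)
  orthogonal-root-transport []      {α = α} x≈u α∈Φ x⊥α =
    α , α∈Φ , trans (⟨⟩-cong (≈ᴹ-sym x≈u) ≈ᴹ-refl) x⊥α , ≈⇒∼ (+ᴹ-cong x≈u ≈ᴹ-refl)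
  orthogonal-root-transport (i ∷ w) {u} {x} {α} x≈siwu α∈Φ x⊥α =
    let r≉0 = nonZero (root∈Φ i)
        s   = reflect (root i)
        sx≈wu = ≈ᴹ-trans (reflect-cong ≈ᴹ-refl x≈siwu) (reflect-involutive r≉0 (act w u))
        β , β∈Φ , u⊥β , sx+sα∼u+β = orthogonal-root-transport w sx≈wu (reflectionClosed (root∈Φ i) α∈Φ)
                                       (trans (reflect-isometry r≉0 x α) x⊥α)
    in β , β∈Φ , u⊥β ,
       ≐-trans (≐-sym (reflect-∼ (root∈Φ i) (x +ᴹ α)))
         (≐-trans (≈⇒∼ (reflect-+ (root i) x α)) sx+sα∼u+β)

-- Moves at a fixed representative, and joins for each rank 2 type.

module Firing {c ℓ₁ ℓ₂ m ℓm : Level} {ℝ : RealNumbers c ℓ₁ ℓ₂}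
              {V : InnerProductSpace ℝ m ℓm} {R : RootSystem V} (S : SimpleRoots R) where
  open RealNumbers ℝ hiding (zero)
  open RealArithmetic ℝ
  open RingProperties ring
  open InnerProductSpace V
  open Module vectorSpace using (≈ᴹ-refl; ≈ᴹ-sym; ≈ᴹ-trans; +ᴹ-cong; -ᴹ‿cong)
  open EuclideanGeometry V
  open RootSystem R
  open WeylOrbits R
  open SimpleRoots S
  open Solver using (con; _:-_; _:*_; _:=_; solve)
  open import Relation.Binary.Reasoning.Setoid setoid

  -- One of `α` and `-ᴹ α` is positive, and both lead to the same orbit; from here on the sign of a
  -- fired root can be ignored.
  fire : ∀ {O O′ u α} → O ≐ orbit u → α ∈ Φ → u ⊥ α → O′ ≐ orbit (u +ᴹ α) → O ⟶ O′
  fire {u = u} {α} O≐u α∈Φ u⊥α O′≐u+α with signed α∈Φ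
  ... | inj₁ α≥0  = u , α , O≐u , (α∈Φ , α≥0) , u⊥α , O′≐u+α
  ... | inj₂ -α≥0 = u , -ᴹ α , O≐u , (Φ-neg α∈Φ , -α≥0) , ⊥-neg u⊥α , ≐-trans O′≐u+α (neg-summand-∼ α∈Φ u⊥α)

  unfire : ∀ {O O′ u} → O ≐ orbit u → O ⟶ O′ → ∃[ α ] (α ∈ Φ × u ⊥ α × O′ ≐ orbit (u +ᴹ α))
  unfire O≐u (x , α , O≐x , (α∈Φ , _) , x⊥α , O′≐x+α) =
    let w , x≈wu = proj₁ O≐u (proj₂ O≐x ([] , ≈ᴹ-refl))
        β , β∈Φ , u⊥β , x+α∼u+β = orthogonal-root-transport w x≈wu α∈Φ x⊥α
    in β , β∈Φ , u⊥β , ≐-trans O′≐x+α x+α∼u+β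

  infix 4 _⇝_
  _⇝_ : Carrierᴹ → Carrierᴹ → Set _
  x ⇝ y = x ∼ y ⊎ orbit x ⟶ orbit y

  Joinable : Carrierᴹ → Carrierᴹ → Set _
  Joinable x y = ∃[ z ] (x ⇝ z × y ⇝ z)

  Joinable-sym : ∀ {x y} → Joinable x y → Joinable y x
  Joinable-sym (z , p , q) = z , q , p

  ⇝-respˡ : ∀ {x y z} → x ∼ y → x ⇝ z → y ⇝ z
  ⇝-respˡ x∼y (inj₁ x∼z) = inj₁ (≐-trans (≐-sym x∼y) x∼z)
  ⇝-respˡ x∼y (inj₂ (u , α , x≐u , rest)) = inj₂ (u , α , ≐-trans (≐-sym x∼y) x≐u , rest)

  Joinable-respˡ : ∀ {x x′ y} → x ∼ x′ → Joinable x y → Joinable x′ y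
  Joinable-respˡ x∼x′ (z , p , q) = z , ⇝-respˡ x∼x′ p , q

  ∼⇒Joinable : ∀ {x y} → x ∼ y → Joinable x y
  ∼⇒Joinable {x} {y} x∼y = y , inj₁ x∼y , inj₁ ≐-refl

  module _ {u : Carrierᴹ} where

    -- Each root is still orthogonal to the point after the other has been fired, so the two moves
    -- commute.
    join-orthogonal : ∀ {α β} → α ∈ Φ → β ∈ Φ → u ⊥ α → u ⊥ β → β ⊥ α → Joinable (u +ᴹ α) (u +ᴹ β)
    join-orthogonal {α} {β} α∈Φ β∈Φ u⊥α u⊥β β⊥α =
      u +ᴹ α +ᴹ β
      , inj₂ (fire ≐-refl β∈Φ (⊥-+ u⊥β (⊥-sym β⊥α)) ≐-refl)
      , inj₂ (fire ≐-refl α∈Φ (⊥-+ u⊥α β⊥α) (≈⇒∼ (solveᵛ [] (u ∷ α ∷ β ∷ [])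
          (vec 0F ⊕ vec 1F ⊕ vec 2F) (vec 0F ⊕ vec 2F ⊕ vec 1F) (λ _ → refl))))

  module _ {u α β : Carrierᴹ} (α∈Φ : α ∈ Φ) (β∈Φ : β ∈ Φ) (u⊥α : u ⊥ α) (u⊥β : u ⊥ β) where
    private
      sβα∈Φ = reflectionClosed β∈Φ α∈Φ
      sαβ∈Φ = reflectionClosed α∈Φ β∈Φ
      u⊥sβα = ⊥-reflect u⊥β u⊥α
      u⊥sαβ = ⊥-reflect u⊥α u⊥β
      αα = pairing-self (nonZero α∈Φ)
      ββ = pairing-self (nonZero β∈Φ)

    -- In an A₂ subsystem no further move is needed: reflecting `α` in `β` gives α - β, reflecting
    -- `β` in `α` gives β - α, and these opposite roots yield the same orbit.
    join-11 : pairing β α ≈ fromℤ (+ 1) → pairing α β ≈ fromℤ (+ 1) → Joinable (u +ᴹ α) (u +ᴹ β)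
    join-11 βα αβ = ∼⇒Joinable
      (≐-trans (reflect-summand-∼ β∈Φ u⊥β α)
      (≐-trans (neg-summand-∼ sβα∈Φ u⊥sβα)
      (≐-trans (≈⇒∼ (+ᴹ-cong ≈ᴹ-refl -sβα≈sαβ))
      (≐-sym (reflect-summand-∼ α∈Φ u⊥α β)))))
      where
      -sβα≈sαβ : -ᴹ reflect β α ≈ᴹ reflect α β
      -sβα≈sαβ = ≈ᴹ-trans (-ᴹ‿cong (reflect-by {β} {α} αβ))
        (≈ᴹ-trans (solveᵛ [] (α ∷ β ∷ []) (⊖ (vec 0F ⊕ ⊖ (+ 1 ⊛ vec 1F))) (vec 1F ⊕ ⊖ (+ 1 ⊛ vec 0F)) (λ _ → refl))
        (≈ᴹ-sym (reflect-by {α} {β} βα)))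

    -- In a B₂ subsystem with `β` long, β - α is a short root orthogonal to `α`; firing it at u + α
    -- gives u + β.
    join-21 : pairing β α ≈ fromℤ (+ 2) → pairing α β ≈ fromℤ (+ 1) → Joinable (u +ᴹ α) (u +ᴹ β)
    join-21 βα αβ = u +ᴹ β , inj₂ (fire ≐-refl (Φ-neg sβα∈Φ) u+α⊥γ (≈⇒∼ u+β≈u+α+γ)) , inj₁ ≐-refl
      where
      u+α⊥γ : (u +ᴹ α) ⊥ (-ᴹ reflect β α)
      u+α⊥γ = ⊥-neg (⊥-+ u⊥sβα (⊥-sym (pairing≈0⇒⊥ (nonZero α∈Φ) (pairing-reflectˡ {α} {β} {α} {+ 2} {+ 1} {+ 2} αα αβ βα))))
      u+β≈u+α+γ : u +ᴹ β ≈ᴹ u +ᴹ α +ᴹ -ᴹ reflect β α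
      u+β≈u+α+γ = ≈ᴹ-trans
        (solveᵛ [] (u ∷ α ∷ β ∷ []) (vec 0F ⊕ vec 2F) (vec 0F ⊕ vec 1F ⊕ ⊖ (vec 1F ⊕ ⊖ (+ 1 ⊛ vec 2F))) (λ _ → refl))
        (+ᴹ-cong ≈ᴹ-refl (-ᴹ‿cong (≈ᴹ-sym (reflect-by {β} {α} αβ))))

    -- In a G₂ subsystem, with β long, γ is the long root orthogonal to α and
    -- δ the short root orthogonal to β.
    join-31 : pairing β α ≈ fromℤ (+ 3) → pairing α β ≈ fromℤ (+ 1) → Joinable (u +ᴹ α) (u +ᴹ β)
    join-31 βα αβ = u +ᴹ α +ᴹ γ
      , inj₂ (fire ≐-refl (reflectionClosed β∈Φ sαβ∈Φ) (⊥-+ (⊥-reflect u⊥β u⊥sαβ) α⊥γ) ≐-refl)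
      , inj₂ (fire ≐-refl (reflectionClosed α∈Φ sβα∈Φ) (⊥-+ (⊥-reflect u⊥α u⊥sβα) β⊥δ) u+α+γ∼u+β+δ)
      where
      τ = reflect β α
      γ = reflect β (reflect α β)
      δ = reflect α τ

      sαβ·β : pairing (reflect α β) β ≈ fromℤ -[1+ 0 ]
      sαβ·β = pairing-reflectˡ {β} {α} {β} {+ 2} {+ 3} {+ 1} ββ βα αβ
      τ·α : pairing τ α ≈ fromℤ -[1+ 0 ]
      τ·α = pairing-reflectˡ {α} {β} {α} {+ 2} {+ 1} {+ 3} αα αβ βα
      sαβ·α : pairing (reflect α β) α ≈ fromℤ -[1+ 2 ]
      sαβ·α = pairing-reflectˡ {β} {α} {α} {+ 3} {+ 3} {+ 2} βα βα αα
      τ·β : pairing τ β ≈ fromℤ -[1+ 0 ]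
      τ·β = pairing-reflectˡ {α} {β} {β} {+ 1} {+ 1} {+ 2} αβ αβ ββ

      α⊥γ : α ⊥ γ
      α⊥γ = ⊥-sym (pairing≈0⇒⊥ (nonZero α∈Φ)
        (pairing-reflectˡ {reflect α β} {β} {α} {i = -[1+ 2 ]} { -[1+ 0 ]} {+ 3} sαβ·α sαβ·β βα))
      β⊥δ : β ⊥ δ
      β⊥δ = ⊥-sym (pairing≈0⇒⊥ (nonZero β∈Φ)
        (pairing-reflectˡ {τ} {α} {β} {i = -[1+ 0 ]} { -[1+ 0 ]} {+ 1} τ·β τ·α αβ))

      τ≈ : τ ≈ᴹ α +ᴹ -ᴹ (fromℤ (+ 1) *ₗ β)
      τ≈ = reflect-by {β} {α} αβ
      γ≈ : γ ≈ᴹ (β +ᴹ -ᴹ (fromℤ (+ 3) *ₗ α)) +ᴹ -ᴹ (fromℤ -[1+ 0 ] *ₗ β)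
      γ≈ = ≈ᴹ-trans (reflect-by {β} {reflect α β} sαβ·β) (+ᴹ-cong (reflect-by {α} {β} βα) ≈ᴹ-refl)
      δ≈ : δ ≈ᴹ (α +ᴹ -ᴹ (fromℤ (+ 1) *ₗ β)) +ᴹ -ᴹ (fromℤ -[1+ 0 ] *ₗ α)
      δ≈ = ≈ᴹ-trans (reflect-by {α} {τ} τ·α) (+ᴹ-cong τ≈ ≈ᴹ-refl)

      double-∼ : ∀ {η x} → η ∈ Φ → u ⊥ η → u +ᴹ (x +ᴹ x) ∼ u +ᴹ (reflect η x +ᴹ reflect η x)
      double-∼ {η} {x} η∈Φ u⊥η =
        ≐-trans (reflect-summand-∼ η∈Φ u⊥η (x +ᴹ x)) (≈⇒∼ (+ᴹ-cong ≈ᴹ-refl (reflect-+ η x x)))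

      -- Here τ = α - β, γ = 2β - 3α and δ = 2α - β. Hence u + α + γ = u - 2τ; reflecting in τ gives
      -- u + 2τ, and reflecting that in `β` gives u + 2α = u + β + δ.
      u+α+γ∼u+β+δ : u +ᴹ α +ᴹ γ ∼ u +ᴹ β +ᴹ δ
      u+α+γ∼u+β+δ =
        ≐-trans (≈⇒∼ (≈ᴹ-trans (+ᴹ-cong ≈ᴹ-refl γ≈) (≈ᴹ-trans
          (solveᵛ [] (u ∷ α ∷ β ∷ [])
            (vec 0F ⊕ vec 1F ⊕ ((vec 2F ⊕ ⊖ (+ 3 ⊛ vec 1F)) ⊕ ⊖ (-[1+ 0 ] ⊛ vec 2F)))
            (vec 0F ⊕ (⊖ (vec 1F ⊕ ⊖ (+ 1 ⊛ vec 2F)) ⊕ ⊖ (vec 1F ⊕ ⊖ (+ 1 ⊛ vec 2F))))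
            (λ _ → refl))
          (≈ᴹ-sym (+ᴹ-cong ≈ᴹ-refl (+ᴹ-cong sττ≈ sττ≈))))))
        (≐-trans (≐-sym (double-∼ sβα∈Φ u⊥sβα))
        (≐-trans (≐-sym (double-∼ β∈Φ u⊥β))
        (≈⇒∼ (≈ᴹ-trans
          (solveᵛ [] (u ∷ α ∷ β ∷ [])
            (vec 0F ⊕ (vec 1F ⊕ vec 1F))
            (vec 0F ⊕ vec 2F ⊕ ((vec 1F ⊕ ⊖ (+ 1 ⊛ vec 2F)) ⊕ ⊖ (-[1+ 0 ] ⊛ vec 1F)))
            (λ _ → refl))
          (+ᴹ-cong ≈ᴹ-refl (≈ᴹ-sym δ≈))))))
        where
        sττ≈ : reflect τ τ ≈ᴹ -ᴹ (α +ᴹ -ᴹ (fromℤ (+ 1) *ₗ β))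
        sττ≈ = ≈ᴹ-trans (reflect-self (nonZero sβα∈Φ)) (-ᴹ‿cong τ≈)

  -- Cartan integers of two roots.

  module _ {α β : Carrierᴹ} (α∈Φ : α ∈ Φ) (β∈Φ : β ∈ Φ) {p q : ℤ}
           (βα : pairing β α ≈ fromℤ p) (αβ : pairing α β ≈ fromℤ q) where
    private
      A = ⟨ α , α ⟩
      B = ⟨ β , β ⟩
      b = ⟨ β , α ⟩
      P = fromℤ p
      Q = fromℤ q
      -- Twice the component of `β` orthogonal to `α`.
      d = fromℤ (+ 2) *ₗ β +ᴹ -ᴹ (P *ₗ α)

      PA≈2b : P * A ≈ fromℤ (+ 2) * b
      PA≈2b = trans (*-congʳ (sym βα)) (pairing-norm (nonZero α∈Φ) β)

      QB≈2b : Q * B ≈ fromℤ (+ 2) * b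
      QB≈2b = trans (*-congʳ (sym αβ)) (trans (pairing-norm (nonZero β∈Φ) α) (*-congˡ (⟨⟩-sym α β)))

      ⟨d,⟩ : ∀ z → ⟨ d , z ⟩ ≈ fromℤ (+ 2) * ⟨ β , z ⟩ - P * ⟨ α , z ⟩
      ⟨d,⟩ z = inner-correct (+ 2 ⊛ vec 0F ⊕ ⊖ (0F ⊙ vec 1F)) (P ∷ []) (β ∷ α ∷ []) z

      -- The integer factor is 4 sin² of the angle between the roots. That the norm cannot be
      -- negative bounds the product of the Cartan integers by 4, and equality forces `d` to vanish.
      norm-d : ⟨ d , d ⟩ ≈ fromℤ (+ 4 ℤ.- p ℤ.* q) * B
      norm-d = begin
        ⟨ d , d ⟩
          ≈⟨ ⟨d,⟩ d ⟩
        fromℤ (+ 2) * ⟨ β , d ⟩ - P * ⟨ α , d ⟩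
          ≈⟨ +-cong (*-congˡ (trans (⟨⟩-sym β d) (⟨d,⟩ β))) (-‿cong (*-congˡ (trans (⟨⟩-sym α d) (⟨d,⟩ α)))) ⟩
        fromℤ (+ 2) * (fromℤ (+ 2) * B - P * ⟨ α , β ⟩) - P * (fromℤ (+ 2) * b - P * A)
          ≈⟨ +-cong (*-congˡ (+-congˡ (-‿cong (*-congˡ (⟨⟩-sym α β))))) (-‿cong (*-congˡ (+-congˡ (-‿cong PA≈2b)))) ⟩
        fromℤ (+ 2) * (fromℤ (+ 2) * B - P * b) - P * (fromℤ (+ 2) * b - fromℤ (+ 2) * b)
          ≈⟨ solve 3 (λ B P b → con (+ 2) :* (con (+ 2) :* B :- P :* b) :- P :* (con (+ 2) :* b :- con (+ 2) :* b)
                      := con (+ 4) :* B :- P :* (con (+ 2) :* b)) refl B P b ⟩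
        fromℤ (+ 4) * B - P * (fromℤ (+ 2) * b)
          ≈⟨ +-congˡ (-‿cong (*-congˡ (sym QB≈2b))) ⟩
        fromℤ (+ 4) * B - P * (Q * B)
          ≈⟨ solve 3 (λ B P Q → con (+ 4) :* B :- P :* (Q :* B) := (con (+ 4) :- P :* Q) :* B) refl B P Q ⟩
        (fromℤ (+ 4) - P * Q) * B
          ≈⟨ *-congʳ (+-congˡ (trans (-‿cong (sym (fromℤ-* p q))) (sym (fromℤ-neg (p ℤ.* q))))) ⟩
        (fromℤ (+ 4) + fromℤ (ℤ.- (p ℤ.* q))) * B
          ≈⟨ *-congʳ (sym (fromℤ-+ (+ 4) (ℤ.- (p ℤ.* q)))) ⟩
        fromℤ (+ 4 ℤ.- p ℤ.* q) * B ∎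

    cartan-product≤4 : p ℤ.* q ℤ.≤ + 4
    cartan-product≤4 = ℤ.0≤i-j⇒j≤i (nonNeg _ ≡.refl)
      where
      nonNeg : ∀ i → i ≡ + 4 ℤ.- p ℤ.* q → + 0 ℤ.≤ i
      nonNeg (+ n)    _  = ℤ.+≤+ z≤n
      nonNeg -[1+ n ] eq = ⊥-elim (¬Positive-neg (Positive-* (Positive-fromℕ n) (Positive-norm (nonZero β∈Φ)))
        (≤-respʳ-≈ (trans norm-d (trans (*-congʳ (reflexive (≡.cong fromℤ (≡.sym eq)))) (sym (-‿distribˡ-* _ B))))
          (⟨⟩-nonNeg d)))

    cartan-product≡4⇒proportional : p ℤ.* q ≡ + 4 → fromℤ (+ 2) *ₗ β ≈ᴹ P *ₗ α
    cartan-product≡4⇒proportional pq≡4 = x-y≈0⇒x≈yᴹ (⟨⟩-definite d (trans norm-d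
      (trans (*-congʳ (reflexive (≡.cong (λ k → fromℤ (+ 4 ℤ.- k)) pq≡4))) (zeroˡ B))))

    -- Both P * A and Q * B equal 2⟨β, α⟩, and `A` and `B` are positive, so `p` and `q` have the
    -- same sign.
    cartan-sign : ∀ {k} → p ≡ + suc k → ∃[ l ] q ≡ + suc l
    cartan-sign {k} ≡.refl = positive q ≡.refl
      where
      QB>0 : Positive (Q * B)
      QB>0 = Positive-resp (trans PA≈2b (sym QB≈2b)) (Positive-* (Positive-fromℕ k) (Positive-norm (nonZero α∈Φ)))
      positive : ∀ i → i ≡ q → ∃[ l ] i ≡ + suc l
      positive (+ suc l) _      = l , ≡.refl
      positive (+ zero)  ≡.refl = ⊥-elim (proj₂ QB>0 (zeroˡ B))
      positive -[1+ n ]  ≡.refl = ⊥-elim (¬Positive-neg (Positive-* (Positive-fromℕ n) (Positive-norm (nonZero β∈Φ)))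
        (≤-respʳ-≈ (sym (-‿distribˡ-* _ B)) (proj₁ QB>0)))

  -- Otherwise 2β would be a root, contradicting `reduced`, because 2 is neither 1 nor -1. This
  -- excludes the Cartan pairs (1, 4) and (4, 1).
  double∉Φ : ∀ {α β} → α ∈ Φ → β ∈ Φ → ¬ fromℤ (+ 2) *ₗ β ≈ᴹ fromℤ (+ 1) *ₗ α
  double∉Φ {α} {β} α∈Φ β∈Φ eq with reduced (fromℤ (+ 2)) β∈Φ
    (Φ-resp-≈ (≈ᴹ-trans (solveᵛ [] (α ∷ []) (vec 0F) (+ 1 ⊛ vec 0F) (λ _ → refl)) (≈ᴹ-sym eq)) α∈Φ)
  ... | inj₁ 2≈1  with () ← fromℤ-injective {+ 2} {+ 1} (trans 2≈1 (sym fromℤ-1))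
  ... | inj₂ 2≈-1 with () ← fromℤ-injective {+ 2} { -[1+ 0 ]} (trans 2≈-1 (-‿cong (sym fromℤ-1)))

  module _ {u : Carrierᴹ} where

    -- Up to exchanging the roots, the pairs of positive integers with product at most 4 are (1, 1),
    -- (1, 2) and (1, 3), joined above; (1, 4), excluded by reducedness; and (2, 2), where
    -- proportionality gives α = β. The remaining clauses contradict the bound.
    join-positive : ∀ {α β} → α ∈ Φ → β ∈ Φ → u ⊥ α → u ⊥ β →
                    ∀ k l → pairing β α ≈ fromℤ (+ suc k) → pairing α β ≈ fromℤ (+ suc l) →
                    suc k ℕ.* suc l ℕ.≤ 4 → Joinable (u +ᴹ α) (u +ᴹ β)
    join-positive α∈Φ β∈Φ u⊥α u⊥β 0 0 βα αβ _ = join-11 α∈Φ β∈Φ u⊥α u⊥β βα αβ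
    join-positive α∈Φ β∈Φ u⊥α u⊥β 0 1 βα αβ _ = Joinable-sym (join-21 β∈Φ α∈Φ u⊥β u⊥α αβ βα)
    join-positive α∈Φ β∈Φ u⊥α u⊥β 0 2 βα αβ _ = Joinable-sym (join-31 β∈Φ α∈Φ u⊥β u⊥α αβ βα)
    join-positive α∈Φ β∈Φ u⊥α u⊥β 1 0 βα αβ _ = join-21 α∈Φ β∈Φ u⊥α u⊥β βα αβ
    join-positive α∈Φ β∈Φ u⊥α u⊥β 2 0 βα αβ _ = join-31 α∈Φ β∈Φ u⊥α u⊥β βα αβ
    join-positive α∈Φ β∈Φ u⊥α u⊥β 0 3 βα αβ _ =
      ⊥-elim (double∉Φ α∈Φ β∈Φ (cartan-product≡4⇒proportional α∈Φ β∈Φ {+ 1} {+ 4} βα αβ ≡.refl))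
    join-positive α∈Φ β∈Φ u⊥α u⊥β 3 0 βα αβ _ =
      ⊥-elim (double∉Φ β∈Φ α∈Φ (cartan-product≡4⇒proportional β∈Φ α∈Φ {+ 1} {+ 4} αβ βα ≡.refl))
    join-positive α∈Φ β∈Φ u⊥α u⊥β 1 1 βα αβ _ = ∼⇒Joinable (≈⇒∼ (+ᴹ-cong ≈ᴹ-refl
      (2x≈2y⇒x≈y (≈ᴹ-sym (cartan-product≡4⇒proportional α∈Φ β∈Φ {+ 2} {+ 2} βα αβ ≡.refl)))))
    join-positive _ _ _ _ 0 (suc (suc (suc (suc _)))) _ _ (s≤s (s≤s (s≤s (s≤s ()))))
    join-positive _ _ _ _ 1 (suc (suc l)) _ _ le =
      ⊥-elim (from-no (6 ℕ.≤? 4) (ℕ.≤-trans (ℕ.*-mono-≤ {2} {2} {3} {3 ℕ.+ l} ℕ.≤-refl (ℕ.m≤m+n 3 l)) le))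
    join-positive _ _ _ _ 2 (suc l) _ _ le =
      ⊥-elim (from-no (6 ℕ.≤? 4) (ℕ.≤-trans (ℕ.*-mono-≤ {3} {3} {2} {2 ℕ.+ l} ℕ.≤-refl (ℕ.m≤m+n 2 l)) le))
    join-positive _ _ _ _ (suc (suc (suc (suc k)))) 0 _ _ (s≤s (s≤s (s≤s (s≤s ()))))
    join-positive _ _ _ _ (suc (suc (suc k))) (suc l) _ _ le =
      ⊥-elim (from-no (8 ℕ.≤? 4) (ℕ.≤-trans (ℕ.*-mono-≤ {4} {4 ℕ.+ k} {2} {2 ℕ.+ l} (ℕ.m≤m+n 4 k) (ℕ.m≤m+n 2 l)) le))

    locally-confluent : ∀ {α β} → α ∈ Φ → β ∈ Φ → u ⊥ α → u ⊥ β → Joinable (u +ᴹ α) (u +ᴹ β)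
    locally-confluent {α} {β} α∈Φ β∈Φ u⊥α u⊥β
      with crystallographic α∈Φ β∈Φ | crystallographic β∈Φ α∈Φ
    ... | + zero  , βα | q , αβ = join-orthogonal α∈Φ β∈Φ u⊥α u⊥β (pairing≈0⇒⊥ (nonZero α∈Φ) βα)
    ... | + suc k , βα | q , αβ with l , ≡.refl ← cartan-sign α∈Φ β∈Φ {p = + suc k} {q} βα αβ ≡.refl =
      join-positive α∈Φ β∈Φ u⊥α u⊥β k l βα αβ (ℤ.drop‿+≤+ (cartan-product≤4 α∈Φ β∈Φ {+ suc k} {+ suc l} βα αβ))
    -- Replacing `β` by its negative keeps the orbit of u + β and makes the Cartan integers
    -- positive.
    ... | -[1+ k ] , βα | _ with crystallographic (Φ-neg β∈Φ) α∈Φ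
    ...   | q , α-β with -βα ← trans (pairing-negˡ β α) (trans (-‿cong βα) (-‿involutive _))
                    with l , ≡.refl ← cartan-sign α∈Φ (Φ-neg β∈Φ) {+ suc k} {q} -βα α-β ≡.refl =
      Joinable-sym (Joinable-respˡ (≐-sym (neg-summand-∼ β∈Φ u⊥β)) (Joinable-sym
        (join-positive α∈Φ (Φ-neg β∈Φ) u⊥α (⊥-neg u⊥β) k l -βα α-β
          (ℤ.drop‿+≤+ (cartan-product≤4 α∈Φ (Φ-neg β∈Φ) {+ suc k} {+ suc l} -βα α-β)))))

-- Integer vectors: a separating functional and a potential.

module IntegerVectors where
  open import Algebra.Properties.Semiring.Sum ℤ.+-*-semiring using (sum; sum-cong-≗; *-distribˡ-sum; sum-permute)
  open ≡.≡-Reasoning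

  strict-upper-bound : ∀ {k} (f : Fin k → ℕ) → ∃[ N ] (∀ i → f i ℕ.< N)
  strict-upper-bound {zero}  f = 0 , λ ()
  strict-upper-bound {suc k} f =
    let N , f<N = strict-upper-bound (λ i → f (suc i))
    in suc (f zero) ℕ.⊔ N , λ where
      zero    → ℕ.m≤m⊔n (suc (f zero)) N
      (suc i) → ℕ.<-≤-trans (f<N i) (ℕ.m≤n⊔m (suc (f zero)) N)

  infix 8 _·_
  _·_ : ∀ {m} → Vector ℤ m → Vector ℤ m → ℤ
  a · b = sum (λ j → a j ℤ.* b j)

  ·-negʳ : ∀ {m} (a b : Vector ℤ m) → a · (λ j → ℤ.- b j) ≡ ℤ.- (a · b)
  ·-negʳ a b = begin
    sum (λ j → a j ℤ.* ℤ.- b j)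
      ≡⟨ sum-cong-≗ (λ j → solve 2 (λ x y → x :* (:- y) := con ℤ.-1ℤ :* (x :* y)) ≡.refl (a j) (b j)) ⟩
    sum (λ j → ℤ.-1ℤ ℤ.* (a j ℤ.* b j))
      ≡⟨ ≡.sym (*-distribˡ-sum ℤ.-1ℤ (λ j → a j ℤ.* b j)) ⟩
    ℤ.-1ℤ ℤ.* (a · b)
      ≡⟨ ℤ.-1*i≡-i (a · b) ⟩
    ℤ.- (a · b) ∎
    where open +-*-Solver

  private
    -- A digit smaller than the base cannot cancel a nonzero multiple of the base.
    |i|<N⇒i+Ns≢0 : ∀ {N} i s → ℤ.∣ i ∣ ℕ.< N → ¬ s ≡ + 0 → ¬ i ℤ.+ + N ℤ.* s ≡ + 0
    |i|<N⇒i+Ns≢0 {N} i s |i|<N s≢0 eq = ℕ.<⇒≱ |i|<N (≡.subst (N ℕ.≤_) N|s|≡|i|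
      (ℕ.m≤m*n N ℤ.∣ s ∣ {{ℕ.≢-nonZero (λ e → s≢0 (ℤ.∣i∣≡0⇒i≡0 e))}}))
      where
      N|s|≡|i| : N ℕ.* ℤ.∣ s ∣ ≡ ℤ.∣ i ∣
      N|s|≡|i| = begin
        N ℕ.* ℤ.∣ s ∣          ≡⟨ ≡.sym (ℤ.abs-* (+ N) s) ⟩
        ℤ.∣ + N ℤ.* s ∣        ≡⟨ ≡.sym (ℤ.∣-i∣≡∣i∣ (+ N ℤ.* s)) ⟩
        ℤ.∣ ℤ.- (+ N ℤ.* s) ∣  ≡⟨ ≡.cong ℤ.∣_∣ (≡.sym (ℤ.i-j≡0⇒i≡j i (ℤ.- (+ N ℤ.* s))
                                     (≡.trans (≡.cong (λ x → i ℤ.+ x) (ℤ.neg-involutive (+ N ℤ.* s))) eq))) ⟩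
        ℤ.∣ i ∣                ∎

  -- c = (1, N, N², …) for N large compared with the entries, so that c · C i is
  -- a number written in base N with digits C i j.
  regular-functional : ∀ {k} m (C : Fin k → Vector ℤ m) →
                       ∃[ c ] (∀ i → (∃[ j ] ¬ C i j ≡ + 0) → ¬ c · C i ≡ + 0)
  regular-functional zero    C = (λ ()) , λ _ ()
  regular-functional {k} (suc m) C = c , λ i (j , Cᵢⱼ≢0) → regular i (s i ℤ.≟ + 0) j Cᵢⱼ≢0
    where
    -- The base is chosen anew for each column: it only has to exceed the entries of that column in
    -- absolute value.
    bound = strict-upper-bound (λ i → ℤ.∣ C i zero ∣)
    N = proj₁ bound
    tail = regular-functional m (λ i j → C i (suc j))
    s : Fin k → ℤ
    s i = proj₁ tail · (λ j → C i (suc j))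

    c : Vector ℤ (suc m)
    c zero    = + 1
    c (suc j) = + N ℤ.* proj₁ tail j

    c·C : ∀ i → c · C i ≡ C i zero ℤ.+ + N ℤ.* s i
    c·C i = ≡.cong₂ ℤ._+_ (ℤ.*-identityˡ (C i zero))
      (≡.trans (sum-cong-≗ (λ j → ℤ.*-assoc (+ N) (proj₁ tail j) (C i (suc j))))
               (≡.sym (*-distribˡ-sum (+ N) (λ j → proj₁ tail j ℤ.* C i (suc j)))))

    regular : ∀ i → Dec (s i ≡ + 0) → ∀ j → ¬ C i j ≡ + 0 → ¬ c · C i ≡ + 0
    regular i (no s≢0)  j       _     eq = |i|<N⇒i+Ns≢0 (C i zero) (s i) (proj₂ bound i) s≢0 (≡.trans (≡.sym (c·C i)) eq)
    -- A nonzero entry after the first would make `s i` nonzero, by the property of the tail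
    -- functional.
    regular i (yes s≡0) (suc j) Cⱼ≢0  eq = proj₂ tail i (j , Cⱼ≢0) s≡0
    regular i (yes s≡0) zero    C₀≢0  eq = C₀≢0 (begin
      C i zero                      ≡⟨ ≡.sym (ℤ.+-identityʳ _) ⟩
      C i zero ℤ.+ + 0              ≡⟨ ≡.cong (λ x → C i zero ℤ.+ x) (≡.sym (ℤ.*-zeroʳ (+ N))) ⟩
      C i zero ℤ.+ + N ℤ.* + 0      ≡⟨ ≡.cong (λ x → C i zero ℤ.+ + N ℤ.* x) (≡.sym s≡0) ⟩
      C i zero ℤ.+ + N ℤ.* s i      ≡⟨ ≡.sym (c·C i) ⟩
      c · C i                       ≡⟨ eq ⟩
      + 0                           ∎)

  square : ∀ i → i ℤ.* i ≡ + (ℤ.∣ i ∣ ℕ.* ℤ.∣ i ∣)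
  square (+ n)    = ≡.sym (ℤ.pos-* n n)
  square -[1+ n ] = ≡.refl

  sum-squares : ∀ {m} (a : Vector ℤ m) → ∃[ n ] a · a ≡ + n
  sum-squares {zero}  a = 0 , ≡.refl
  sum-squares {suc m} a =
    let n , eq = sum-squares (λ j → a (suc j))
    in ℤ.∣ a zero ∣ ℕ.* ℤ.∣ a zero ∣ ℕ.+ n , ≡.cong₂ ℤ._+_ (square (a zero)) eq

  -- Reindexing by `π` turns the sum into its own negative.
  sum-odd≡0 : ∀ {m} (f : Vector ℤ m) (π : Permutation′ m) → (∀ j → f (π ⟨$⟩ʳ j) ≡ ℤ.- f j) → sum f ≡ + 0
  sum-odd≡0 f π odd = i≡-i⇒i≡0 (sum f) (begin
    sum f                       ≡⟨ sum-permute f π ⟩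
    sum (λ j → f (π ⟨$⟩ʳ j))    ≡⟨ sum-cong-≗ (λ j → ≡.trans (odd j) (≡.sym (ℤ.*-identityˡ (ℤ.- f j)))) ⟩
    (λ _ → + 1) · (λ j → ℤ.- f j) ≡⟨ ·-negʳ (λ _ → + 1) f ⟩
    ℤ.- ((λ _ → + 1) · f)       ≡⟨ ≡.cong ℤ.-_ (sum-cong-≗ (λ j → ℤ.*-identityˡ (f j))) ⟩
    ℤ.- sum f                   ∎)
    where
    i≡-i⇒i≡0 : ∀ i → i ≡ ℤ.- i → i ≡ + 0
    i≡-i⇒i≡0 (+ zero)  _  = ≡.refl
    i≡-i⇒i≡0 (+ suc n) ()
    i≡-i⇒i≡0 -[1+ n ]  ()

  -- The squared distance from `a` to `d`, valued in ℕ so that it can drive a well-founded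
  -- induction.
  potential : ∀ {m} → Vector ℤ m → Vector ℤ m → ℕ
  potential d a = proj₁ (sum-squares (λ j → a j ℤ.- d j))

  private
    norm-shift : ∀ {m} (d a b : Vector ℤ m) →
      (λ j → a j ℤ.+ b j ℤ.- d j) · (λ j → a j ℤ.+ b j ℤ.- d j) ≡
      (λ j → a j ℤ.- d j) · (λ j → a j ℤ.- d j) ℤ.+ (+ 2 ℤ.* a · b ℤ.+ (b · b ℤ.- + 2 ℤ.* d · b))
    norm-shift {zero}  d a b = ≡.refl
    norm-shift {suc m} d a b =
      ≡.trans (≡.cong (λ x → (a zero ℤ.+ b zero ℤ.- d zero) ℤ.* (a zero ℤ.+ b zero ℤ.- d zero) ℤ.+ x)
                (norm-shift (λ j → d (suc j)) (λ j → a (suc j)) (λ j → b (suc j))))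
        (solve 7 (λ a b d s ab bb db →
          (a :+ b :- d) :* (a :+ b :- d) :+ (s :+ (con (+ 2) :* ab :+ (bb :- con (+ 2) :* db))) :=
          (a :- d) :* (a :- d) :+ s :+ (con (+ 2) :* (a :* b :+ ab) :+ (b :* b :+ bb :- con (+ 2) :* (d :* b :+ db))))
          ≡.refl (a zero) (b zero) (d zero) _ _ _ _)
      where open +-*-Solver

  -- Orthogonality removes the cross term 2 a · b from the expansion of the squared distance,
  -- leaving the negative change b · b - 2 d · b.
  potential-decreases : ∀ {m} (d a b : Vector ℤ m) → a · b ≡ + 0 → b · b ℤ.< + 2 ℤ.* d · b →
                        potential d (λ j → a j ℤ.+ b j) ℕ.< potential d a
  potential-decreases d a b a·b≡0 b·b<2d·b = ℤ.drop‿+<+ (≡.subst₂ ℤ._<_ (≡.sym lhs) (ℤ.+-identityʳ (+ potential d a))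
      (ℤ.+-monoʳ-< (+ potential d a)
        (≡.subst (λ x → b · b ℤ.- + 2 ℤ.* d · b ℤ.< x)
          (ℤ.+-inverseʳ (+ 2 ℤ.* d · b)) (ℤ.+-monoˡ-< (ℤ.- (+ 2 ℤ.* d · b)) b·b<2d·b))))
    where
    lhs : + potential d (λ j → a j ℤ.+ b j) ≡ + potential d a ℤ.+ (b · b ℤ.- + 2 ℤ.* d · b)
    lhs = begin
      + potential d (λ j → a j ℤ.+ b j)
        ≡⟨ ≡.sym (proj₂ (sum-squares (λ j → a j ℤ.+ b j ℤ.- d j))) ⟩
      (λ j → a j ℤ.+ b j ℤ.- d j) · (λ j → a j ℤ.+ b j ℤ.- d j)
        ≡⟨ norm-shift d a b ⟩
      (λ j → a j ℤ.- d j) · (λ j → a j ℤ.- d j) ℤ.+ (+ 2 ℤ.* a · b ℤ.+ (b · b ℤ.- + 2 ℤ.* d · b))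
        ≡⟨ ≡.cong₂ (λ x y → x ℤ.+ (+ 2 ℤ.* y ℤ.+ (b · b ℤ.- + 2 ℤ.* d · b))) (proj₂ (sum-squares (λ j → a j ℤ.- d j))) a·b≡0 ⟩
      + potential d a ℤ.+ (+ 0 ℤ.+ (b · b ℤ.- + 2 ℤ.* d · b))
        ≡⟨ ≡.cong (λ x → + potential d a ℤ.+ x) (ℤ.+-identityˡ (b · b ℤ.- + 2 ℤ.* d · b)) ⟩
      + potential d a ℤ.+ (b · b ℤ.- + 2 ℤ.* d · b)
        ∎

  -- A regular functional `c` has nonzero integer values on the rows, hence of absolute value at
  -- least 1. Scaling it by a `K` above all squared norms makes its values large enough.
  separating-functional : ∀ {k m} (C : Fin k → Vector ℤ m) → (∀ i → ∃[ j ] ¬ C i j ≡ + 0) →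
    ∃[ d ] (∀ i → C i · C i ℤ.< + 2 ℤ.* d · C i ⊎ C i · C i ℤ.< + 2 ℤ.* ℤ.- (d · C i))
  separating-functional C C≢0 = d , λ i → separate i (c · C i) ≡.refl
    where
    bound = strict-upper-bound (λ i → proj₁ (sum-squares (C i)))
    K = proj₁ bound
    c = proj₁ (regular-functional _ C)
    d : Vector ℤ _
    d j = + K ℤ.* c j

    d·C : ∀ i → d · C i ≡ + K ℤ.* c · C i
    d·C i = ≡.trans (sum-cong-≗ (λ j → ℤ.*-assoc (+ K) (c j) (C i j))) (≡.sym (*-distribˡ-sum (+ K) (λ j → c j ℤ.* C i j)))

    large : ∀ i n → C i · C i ℤ.< + 2 ℤ.* (+ K ℤ.* + suc n)
    large i n = ≡.subst₂ ℤ._<_ (≡.sym (proj₂ (sum-squares (C i))))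
      (≡.trans (ℤ.pos-* 2 (K ℕ.* suc n)) (≡.cong (λ x → + 2 ℤ.* x) (ℤ.pos-* K (suc n))))
      (ℤ.+<+ (ℕ.<-≤-trans (proj₂ bound i) (ℕ.≤-trans (ℕ.m≤m*n K (suc n)) (ℕ.m≤n*m (K ℕ.* suc n) 2))))

    separate : ∀ i h → h ≡ c · C i → C i · C i ℤ.< + 2 ℤ.* d · C i ⊎ C i · C i ℤ.< + 2 ℤ.* ℤ.- (d · C i)
    separate i (+ suc n) eq = inj₁ (≡.subst (λ x → C i · C i ℤ.< + 2 ℤ.* x)
      (≡.trans (≡.cong (λ x → + K ℤ.* x) eq) (≡.sym (d·C i))) (large i n))
    separate i -[1+ n ]  eq = inj₂ (≡.subst (λ x → C i · C i ℤ.< + 2 ℤ.* x)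
      (≡.trans (≡.sym (ℤ.neg-distribʳ-* (+ K) -[1+ n ]))
        (≡.cong ℤ.-_ (≡.trans (≡.cong (λ x → + K ℤ.* x) eq) (≡.sym (d·C i))))) (large i n))
    separate i (+ zero)  eq = ⊥-elim (proj₂ (regular-functional _ C) i (C≢0 i) (≡.sym eq))

  -- The second alternative is the first one for the negative of `b`, whose squared norm is the
  -- same.
  potential-descends : ∀ {m} (d a b : Vector ℤ m) → a · b ≡ + 0 →
    b · b ℤ.< + 2 ℤ.* d · b ⊎ b · b ℤ.< + 2 ℤ.* ℤ.- (d · b) →
    potential d (λ j → a j ℤ.+ b j) ℕ.< potential d a ⊎ potential d (λ j → a j ℤ.- b j) ℕ.< potential d a
  potential-descends d a b a·b≡0 (inj₁ lt) = inj₁ (potential-decreases d a b a·b≡0 lt)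
  potential-descends d a b a·b≡0 (inj₂ lt) = inj₂ (potential-decreases d a (λ j → ℤ.- b j)
    (≡.trans (·-negʳ a b) (≡.cong ℤ.-_ a·b≡0))
    (≡.subst₂ ℤ._<_ (≡.sym (sum-cong-≗ (λ j → neg*neg (b j)))) (≡.cong (λ x → + 2 ℤ.* x) (≡.sym (·-negʳ d b))) lt))
    where
    neg*neg : ∀ i → ℤ.- i ℤ.* ℤ.- i ≡ i ℤ.* i
    neg*neg i = solve 1 (λ x → :- x :* :- x := x :* x) ≡.refl i
      where open +-*-Solver

-- Termination: integral coordinates and their height.

module Convergence {c ℓ₁ ℓ₂ m ℓm : Level} {ℝ : RealNumbers c ℓ₁ ℓ₂}
                   {V : InnerProductSpace ℝ m ℓm} {R : RootSystem V} (S : SimpleRoots R) where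
  open RealNumbers ℝ hiding (zero)
  open RealArithmetic ℝ
  open InnerProductSpace V
  open Module vectorSpace using (≈ᴹ-refl; ≈ᴹ-sym; ≈ᴹ-trans; +ᴹ-cong)
  open EuclideanGeometry V
  open RootSystem R
  open WeylOrbits R
  open SimpleRoots S
  open Firing S
  open IntegerVectors
  open import Relation.Binary.Reasoning.Setoid setoid

  private
    Orbit = Pred Carrierᴹ ℓm
    roots = distinct-enumeration root
    n = proj₁ roots
    g = proj₁ (proj₂ roots)
    g-injective = proj₁ (proj₂ (proj₂ roots))

    g∈Φ : ∀ j → g j ∈ Φ
    g∈Φ = proj₂ (proj₂ (proj₂ (proj₂ roots)))

    g≉0 : ∀ j → ¬ g j ≈ᴹ 0ᴹ
    g≉0 j = nonZero (g∈Φ j)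

    index : ∀ {α} → α ∈ Φ → ∃[ j ] α ≈ᴹ g j
    index (i , α≈rᵢ) with j , rᵢ≈gⱼ ← proj₁ (proj₂ (proj₂ (proj₂ roots))) i = j , ≈ᴹ-trans α≈rᵢ rᵢ≈gⱼ

    reflect-index : Fin n → Fin n → Fin n
    reflect-index i j = proj₁ (index (reflectionClosed (g∈Φ i) (g∈Φ j)))

    g-reflect : ∀ i j → reflect (g i) (g j) ≈ᴹ g (reflect-index i j)
    g-reflect i j = proj₂ (index (reflectionClosed (g∈Φ i) (g∈Φ j)))

    reflect-index-involutive : ∀ i j → reflect-index i (reflect-index i j) ≡ j
    reflect-index-involutive i j = g-injective (≈ᴹ-trans (≈ᴹ-sym (g-reflect i (reflect-index i j)))
      (≈ᴹ-trans (reflect-cong ≈ᴹ-refl (≈ᴹ-sym (g-reflect i j))) (reflect-involutive (g≉0 i) (g j))))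

    reflection : Fin n → Permutation′ n
    reflection i = permutation (reflect-index i) (reflect-index i)
      (reflect-index-involutive i) (reflect-index-involutive i)

  -- Coordinates are indexed by all distinct roots and not by a basis, so that a reflection acts on
  -- them by a permutation.
  record Coordinates (u : Carrierᴹ) (a : Vector ℤ n) : Set ℓ₁ where
    constructor coords
    field
      coord : ∀ j → pairing u (g j) ≈ fromℤ (a j)

  open Coordinates

  coordinates : ∀ {u} → u ∈ WeightLattice → ∃[ a ] Coordinates u a
  coordinates u∈P = (λ j → proj₁ (u∈P (g∈Φ j))) , coords (λ j → proj₂ (u∈P (g∈Φ j)))

  Coordinates-+ : ∀ {u v a b} → Coordinates u a → Coordinates v b → Coordinates (u +ᴹ v) (λ j → a j ℤ.+ b j)
  Coordinates-+ {u} {v} {a} {b} ua vb .coord j =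
    trans (⟨⟩-additive u v (coroot (g j))) (trans (+-cong (coord ua j) (coord vb j)) (sym (fromℤ-+ (a j) (b j))))

  Coordinates-neg : ∀ {u a} → Coordinates u a → Coordinates (-ᴹ u) (λ j → ℤ.- a j)
  Coordinates-neg {u} {a} ua .coord j = trans (pairing-negˡ u (g j)) (trans (-‿cong (coord ua j)) (sym (fromℤ-neg (a j))))

  private
    -- The Cartan integers ⟨gᵢ, gⱼ^∨⟩ of all pairs of roots; row `i` is the coordinate vector of
    -- `g i`.
    C : Fin n → Vector ℤ n
    C i = proj₁ (coordinates λ α∈Φ → crystallographic α∈Φ (g∈Φ i))

    C-coordinates : ∀ i → Coordinates (g i) (C i)
    C-coordinates i = proj₂ (coordinates λ α∈Φ → crystallographic α∈Φ (g∈Φ i))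

    C-diagonal : ∀ i → C i i ≡ + 2
    C-diagonal i = fromℤ-injective (trans (sym (coord (C-coordinates i) i)) (pairing-self (g≉0 i)))

    C-nonZero : ∀ i → ∃[ j ] ¬ C i j ≡ + 0
    C-nonZero i = i , λ Cᵢᵢ≡0 → contradiction (≡.trans (≡.sym (C-diagonal i)) Cᵢᵢ≡0) λ ()

    d = proj₁ (separating-functional C C-nonZero)

    -- The reflection in gᵢ preserves the coordinates of u and negates those of
    -- gᵢ.
    ⊥⇒coordinates·C≡0 : ∀ {u a i} → Coordinates u a → u ⊥ g i → a · C i ≡ + 0
    ⊥⇒coordinates·C≡0 {u} {a} {i} ua u⊥gᵢ = sum-odd≡0 (λ j → a j ℤ.* C i j) (reflection i) λ j →
      ≡.trans (≡.cong₂ ℤ._*_ (even j) (odd j)) (≡.sym (ℤ.neg-distribʳ-* (a j) (C i j)))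
      where
      pairing-σ : ∀ v j → pairing v (g (reflect-index i j)) ≈ pairing (reflect (g i) v) (g j)
      pairing-σ v j = trans (pairing-cong ≈ᴹ-refl (≈ᴹ-sym (g-reflect i j))) (pairing-reflectʳ (g≉0 i) v (g j))
      even : ∀ j → a (reflect-index i j) ≡ a j
      even j = fromℤ-injective (begin
        fromℤ (a (reflect-index i j))        ≈⟨ sym (coord ua (reflect-index i j)) ⟩
        pairing u (g (reflect-index i j))    ≈⟨ pairing-σ u j ⟩
        pairing (reflect (g i) u) (g j)      ≈⟨ pairing-cong (reflect-fix (g≉0 i) u⊥gᵢ) ≈ᴹ-refl ⟩
        pairing u (g j)                      ≈⟨ coord ua j ⟩
        fromℤ (a j)                          ∎)
      odd : ∀ j → C i (reflect-index i j) ≡ ℤ.- C i j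
      odd j = fromℤ-injective (begin
        fromℤ (C i (reflect-index i j))        ≈⟨ sym (coord (C-coordinates i) (reflect-index i j)) ⟩
        pairing (g i) (g (reflect-index i j))  ≈⟨ pairing-σ (g i) j ⟩
        pairing (reflect (g i) (g i)) (g j)    ≈⟨ pairing-cong (reflect-self (g≉0 i)) ≈ᴹ-refl ⟩
        pairing (-ᴹ g i) (g j)                 ≈⟨ coord (Coordinates-neg (C-coordinates i)) j ⟩
        fromℤ (ℤ.- C i j)                      ∎)

  abstract
    height : Vector ℤ n → ℕ
    height = potential d

  -- The height belongs to a representative and not to its orbit. A move determines only the orbit
  -- `O`, so the representative u + β may be chosen with the sign of the root that lowers the
  -- height.
  Descent : Orbit → Carrierᴹ → Vector ℤ n → Set _
  Descent O u a =
    ∃[ β ] ∃[ a′ ] (β ∈ Φ × u ⊥ β × O ≐ orbit (u +ᴹ β) × Coordinates (u +ᴹ β) a′ × height a′ ℕ.< height a)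

  abstract
    descend : ∀ {O O′ u a} → Coordinates u a → O ≐ orbit u → O ⟶ O′ → Descent O′ u a
    descend {O} {O′} {u} {a} ua O≐u O⟶O′
      with α , α∈Φ , u⊥α , O′≐u+α ← unfire O≐u O⟶O′ with i , α≈gᵢ ← index α∈Φ =
      choose (potential-descends d a (C i) (⊥⇒coordinates·C≡0 ua u⊥gᵢ) (proj₂ (separating-functional C C-nonZero) i))
      where
      u⊥gᵢ : u ⊥ g i
      u⊥gᵢ = trans (⟨⟩-cong ≈ᴹ-refl (≈ᴹ-sym α≈gᵢ)) u⊥α
      O′≐u+gᵢ : O′ ≐ orbit (u +ᴹ g i)
      O′≐u+gᵢ = ≐-trans O′≐u+α (≈⇒∼ (+ᴹ-cong ≈ᴹ-refl α≈gᵢ))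
      choose : height (λ j → a j ℤ.+ C i j) ℕ.< height a ⊎ height (λ j → a j ℤ.- C i j) ℕ.< height a → Descent O′ u a
      choose (inj₁ lt) = g i , _ , g∈Φ i , u⊥gᵢ , O′≐u+gᵢ , Coordinates-+ ua (C-coordinates i) , lt
      choose (inj₂ lt) = -ᴹ g i , _ , Φ-neg (g∈Φ i) , ⊥-neg u⊥gᵢ , ≐-trans O′≐u+gᵢ (neg-summand-∼ (g∈Φ i) u⊥gᵢ) ,
        Coordinates-+ ua (Coordinates-neg (C-coordinates i)) , lt

  -- Representatives chosen one after another along the sequence have strictly decreasing heights.
  no-infinite-firing : ∀ {u a} → Coordinates u a → Acc ℕ._<_ (height a) →
    ∀ (f : ℕ → Orbit) → f zero ≐ orbit u → ¬ (∀ k → f k ⟶ f (suc k))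
  no-infinite-firing ua (acc rs) f f₀≐u f⟶ with _ , _ , _ , _ , f₁≐u′ , u′a′ , lt ← descend ua f₀≐u (f⟶ zero) =
    no-infinite-firing u′a′ (rs lt) (λ k → f (suc k)) f₁≐u′ (λ k → f⟶ (suc k))

  -- Newman's lemma for orbits.

  ⟶-respˡ : ∀ {O O₁ O′} → O ≐ O₁ → O ⟶ O′ → O₁ ⟶ O′
  ⟶-respˡ O≐O₁ (u , α , O≐u , rest) = u , α , ≐-trans (≐-sym O≐O₁) O≐u , rest

  Reaches : Orbit → Carrierᴹ → Set _
  Reaches O w = ∃[ O′ ] (Star _⟶_ O O′ × IsNormalForm _⟶_ O′ × O′ ≐ orbit w)

  -- Orbits are predicates compared by `≐`. An empty sequence from `O` becomes the empty sequence
  -- from `O₁`, so the endpoint itself changes and is fixed only up to `≐`.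
  Reaches-resp : ∀ {O O₁ w w₁} → O ≐ O₁ → w ∼ w₁ → Reaches O w → Reaches O₁ w₁
  Reaches-resp O≐O₁ w∼w₁ (O , ε , normal , O≐w) =
    _ , ε , (λ (O′ , O₁⟶O′) → normal (O′ , ⟶-respˡ (≐-sym O≐O₁) O₁⟶O′)) , ≐-trans (≐-sym O≐O₁) (≐-trans O≐w w∼w₁)
  Reaches-resp O≐O₁ w∼w₁ (O′ , step ◅ steps , normal , O′≐w) =
    O′ , ⟶-respˡ O≐O₁ step ◅ steps , normal , ≐-trans O′≐w w∼w₁

  -- The field `next` carries the limit across one move: `w` can still be reached afterwards,
  -- whichever move was made.
  record Converges (O : Orbit) (w : Carrierᴹ) : Set (ℓ₁ ⊔ m ⊔ lsuc ℓm) where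
    field
      reaches : Reaches O w
      unique  : ∀ {O′} → Star _⟶_ O O′ → IsNormalForm _⟶_ O′ → O′ ≐ orbit w
      next    : ∀ {O′} → O ⟶ O′ → Reaches O′ w

  open Converges

  -- From the common point `z` the limit `w` of `x` is still reachable. It is therefore reachable
  -- from `y`, whose limit is unique.
  joinable-limits : ∀ {x y w w′} → Joinable x y → Converges (orbit x) w → Converges (orbit y) w′ → w ∼ w′
  joinable-limits {x} {y} {w} (z , x⇝z , y⇝z) x↓w y↓w′ =
    let _ , steps , normal , O≐w = back y⇝z (forth x⇝z)
    in ≐-trans (≐-sym O≐w) (unique y↓w′ steps normal)
    where
    forth : x ⇝ z → Reaches (orbit z) w
    forth (inj₁ x∼z) = Reaches-resp x∼z ≐-refl (reaches x↓w)
    forth (inj₂ x⟶z) = next x↓w x⟶z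
    back : y ⇝ z → Reaches (orbit z) w → Reaches (orbit y) w
    back (inj₁ y∼z) r = Reaches-resp (≐-sym y∼z) ≐-refl r
    back (inj₂ y⟶z) (O , steps , rest) = O , y⟶z ◅ steps , rest

  -- Well-founded induction on the height. All points one move away, taken at lower representatives,
  -- converge by induction, and local confluence makes their limits agree.
  converges : ∀ {u a} → Coordinates u a → Acc ℕ._<_ (height a) → ∃[ w ] Converges (orbit u) w
  converges {u} {a} ua (acc rs) with any? (λ i → ⟨ u , root i ⟩ ≟ 0#)
  ... | no ¬⊥ = u , record
    { reaches = orbit u , ε , stuck , ≐-refl
    ; unique  = λ where
        ε            _ → ≐-refl
        (step ◅ _)   _ → ⊥-elim (stuck (_ , step))
    ; next    = λ step → ⊥-elim (stuck (_ , step))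
    }
    where
    stuck : IsNormalForm _⟶_ (orbit u)
    stuck (_ , step) with α , (i , α≈rᵢ) , u⊥α , _ ← unfire ≐-refl step =
      ¬⊥ (i , trans (⟨⟩-cong ≈ᴹ-refl (≈ᴹ-sym α≈rᵢ)) u⊥α)
  -- The limit `w` is that of one arbitrary first move; `after` compares every first move with it.
  ... | yes (i , u⊥rᵢ) with firstStep ← fire ≐-refl (root∈Φ i) u⊥rᵢ ≐-refl
                       with β , _ , β∈Φ , u⊥β , O₁≐u+β , u+βa , lt ← descend ua ≐-refl firstStep
                       with w , u+β↓w ← converges u+βa (rs lt) = w , record
    { reaches = prepend (reaches u+β↓w)
    ; unique  = λ where
        ε              normal → ⊥-elim (normal (_ , firstStep))
        (step ◅ steps) normal → proj₂ (after step) steps normal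
    ; next    = λ step → proj₁ (after step)
    }
    where
    prepend : Reaches (orbit (u +ᴹ β)) w → Reaches (orbit u) w
    prepend (O , steps , rest) = O , fire ≐-refl β∈Φ u⊥β ≐-refl ◅ steps , rest

    Unique : Orbit → Set _
    Unique O = ∀ {O′} → Star _⟶_ O O′ → IsNormalForm _⟶_ O′ → O′ ≐ orbit w

    after : ∀ {O} → orbit u ⟶ O → Reaches O w × Unique O
    after {O} step with γ , _ , γ∈Φ , u⊥γ , O≐u+γ , u+γa , lt′ ← descend ua ≐-refl step
                 with w′ , u+γ↓w′ ← converges u+γa (rs lt′) =
      Reaches-resp (≐-sym O≐u+γ) w′∼w (reaches u+γ↓w′) , limit
      where
      w′∼w : w′ ∼ w
      w′∼w = joinable-limits (locally-confluent γ∈Φ β∈Φ u⊥γ u⊥β) u+γ↓w′ u+β↓w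
      limit : Unique O
      limit ε              normal = ≐-trans O≐u+γ (≐-trans
        (unique u+γ↓w′ ε (λ (O′ , s) → normal (O′ , ⟶-respˡ (≐-sym O≐u+γ) s))) w′∼w)
      limit (step ◅ steps) normal = ≐-trans (unique u+γ↓w′ (⟶-respˡ O≐u+γ step ◅ steps) normal) w′∼w

theorem1p2 : {c ℓ₁ ℓ₂ m ℓm : Level}
    (ℝ : RealNumbers c ℓ₁ ℓ₂) (V : InnerProductSpace ℝ m ℓm)
    (R : RootSystem V) (S : SimpleRoots R) →
    let open InnerProductSpace V
        open RootSystem R
        open SimpleRoots S
    in (v : Carrierᴹ) → v ∈ WeightLattice →
       ∃[ v′ ]
         ( ¬ (∃ λ (f : ℕ → Pred Carrierᴹ ℓm) →
                f zero ≐ orbit v × (∀ n → f n ⟶ f (suc n)))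
         × (∀ {O} → Star _⟶_ (orbit v) O → IsNormalForm _⟶_ O → O ≐ orbit v′) )
theorem1p2 ℝ V R S v v∈P =
  let open Convergence S
      a , va = coordinates v∈P
      v′ , v↓v′ = converges va (<-wellFounded (height a))
  in v′ , (λ (f , f₀≐v , f⟶) → no-infinite-firing va (<-wellFounded (height a)) f f₀≐v f⟶) , Converges.unique v↓v′
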